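{- For all $n\ge1$, $$\sum_{\pi\in T_{2n+1}} \mathrm{sign}(\pi)\, q^{\mathrm{lis}(\pi)}=\sum_{\pi\in T_n} q^{2\,\mathrm{lis}(\pi)+1} \qquad\text{and}\qquad \sum_{\pi\in T_{2n+2}} \mathrm{sign}(\pi)\, q^{\mathrm{lis}(\pi)}=(q-1)\sum_{\pi\in T_n} q^{2\,\mathrm{lis}(\pi)+1}.$$
   Context: $T_n$ denotes the set of $321$-avoiding permutations in the symmetric group $\mathcal S_n$, i.e. permutations with no decreasing subsequence of length three. For a permutation $\pi$, $\mathrm{lis}(\pi)$ is the length of a longest increasing subsequence of $\pi$, and $\mathrm{sign}(\pi)\in\{1,-1\}$ is its sign. $q$ is a formal variable. -}

module Defs where

open import Data.Nat as ℕ using (ℕ; zero; suc; _<ᵇ_; _≡ᵇ_)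
open import Data.Integer as ℤ using (ℤ; +_; -_)
open import Data.Bool.ListAction using (any)
open import Data.Bool using (Bool; true; false; if_then_else_; _∧_; _∨_; not)
open import Data.Fin using (Fin; toℕ)
open import Data.Vec using (Vec; []; _∷_; toList)
open import Data.List as L using (List; []; _∷_; _++_; map; foldr; concatMap; filter; length)
open import Relation.Binary.PropositionalEquality using (_≡_)

allVecs : (n m : ℕ) → List (Vec (Fin m) n)
allVecs zero    m = [] ∷ []
allVecs (suc n) m = concatMap (λ v → map (_∷ v) (L.allFin m)) (allVecs n m)

oneLine : ∀ {n} → Vec (Fin n) n → List ℕ
oneLine v = L.map toℕ (toList v)

distinctᵇ : List ℕ → Bool
distinctᵇ []       = true
distinctᵇ (x ∷ xs) = not (any (x ≡ᵇ_) xs) ∧ distinctᵇ xs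

-- a map Fin n → Fin n (given as a vector) is a permutation iff injective
isPermᵇ : ∀ {n} → Vec (Fin n) n → Bool
isPermᵇ v = distinctᵇ (oneLine v)

subseqs : List ℕ → List (List ℕ)
subseqs []       = [] ∷ []
subseqs (x ∷ xs) = let s = subseqs xs in map (x ∷_) s ++ s

increasingᵇ : List ℕ → Bool
increasingᵇ []           = true
increasingᵇ (x ∷ [])     = true
increasingᵇ (x ∷ y ∷ ys) = (x <ᵇ y) ∧ increasingᵇ (y ∷ ys)

decreasingᵇ : List ℕ → Bool
decreasingᵇ []           = true
decreasingᵇ (x ∷ [])     = true
decreasingᵇ (x ∷ y ∷ ys) = (y <ᵇ x) ∧ decreasingᵇ (y ∷ ys)

avoids321ᵇ : List ℕ → Bool
avoids321ᵇ w = not (any (λ s → (length s ≡ᵇ 3) ∧ decreasingᵇ s) (subseqs w))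

-- T n : the list of all 321-avoiding permutations in S_n (each exactly once)
T : (n : ℕ) → List (Vec (Fin n) n)
T n = L.filterᵇ (λ v → isPermᵇ v ∧ avoids321ᵇ (oneLine v)) (allVecs n n)

lis : ∀ {n} → Vec (Fin n) n → ℕ
lis v = foldr ℕ._⊔_ 0 (map length (L.filterᵇ increasingᵇ (subseqs (oneLine v))))

inv : List ℕ → ℕ
inv []       = 0
inv (x ∷ xs) = length (L.filterᵇ (_<ᵇ x) xs) ℕ.+ inv xs

sign : ∀ {n} → Vec (Fin n) n → ℤ
sign v = (- ℤ.1ℤ) ℤ.^ inv (oneLine v)

-- Polynomials in q with integer coefficients, as coefficient functions
-- (P k = coefficient of q^k); equality of polynomials = equality of all
-- coefficients.

Poly : Set
Poly = ℕ → ℤ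

_≈ₚ_ : Poly → Poly → Set
P ≈ₚ Q = ∀ k → P k ≡ Q k

0ₚ : Poly
0ₚ _ = ℤ.0ℤ

_+ₚ_ : Poly → Poly → Poly
(P +ₚ Q) k = P k ℤ.+ Q k

mono : ℤ → ℕ → Poly
mono c e k = if e ≡ᵇ k then c else ℤ.0ℤ

sumUpTo : (ℕ → ℤ) → ℕ → ℤ
sumUpTo f zero    = f zero
sumUpTo f (suc k) = sumUpTo f k ℤ.+ f (suc k)

_*ₚ_ : Poly → Poly → Poly
(P *ₚ Q) k = sumUpTo (λ i → P i ℤ.* Q (k ℕ.∸ i)) k

q-1 : Poly
q-1 = mono ℤ.1ℤ 1 +ₚ mono (- ℤ.1ℤ) 0

Σₚ : {A : Set} → List A → (A → Poly) → Poly
Σₚ xs f = foldr (λ x acc → f x +ₚ acc) 0ₚ xs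

{-# OPTIONS --safe #-}
module Submission where

-- A 321-avoiding permutation of length n + 1 is r ∷ π′ with π′ standardising to some π of length n, the
-- values of π below r being increasing; this adds r inversions.  For fixed π the admissible r form an
-- interval 0, …, m, and the longest increasing subsequence using only values ≥ r has length L − min(r, d)
-- for r ≤ m, where L = lis π.  The triple (L, d, m) of r ∷ π′ depends only on r and on that of π, so the
-- sums over T n are the values at (0, 0, 0) of the n-th power of an operator Δ on functions of (L, d, m),
-- with parameter ε = −1 for the signed sum and ε = 1 for the unsigned one.
--
-- After one application of Δ₋₁ the function satisfies three linear relations (Coherent) that Δ₋₁² preserves,
-- and on functions satisfying them Δ₋₁² restricted to even arguments is Δ₁.  This gives the odd case.  The
-- even case is one further application of Δ₋₁, evaluated by the third relation at (0, 0, 0).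

open import Defs
open import Data.Bool using (Bool; true; false; if_then_else_; _∧_; _∨_; not)
open import Data.Bool.ListAction using (any; or)
import Data.Bool.Properties as Boolₚ
open import Data.Fin using (Fin; zero; suc; toℕ; punchIn)
import Data.Fin.Properties as Finₚ
open import Data.Integer as ℤ using (ℤ; 0ℤ; 1ℤ; -1ℤ)
import Data.Integer.Properties as ℤₚ
open import Data.Integer.Tactic.RingSolver using (solve-∀)
open import Data.List using (List; []; _∷_; _++_; map; foldr; length; filterᵇ; concatMap; tabulate; allFin)
import Data.List.Properties as Listₚ
open import Data.Nat as ℕ using (ℕ; zero; suc; _⊓_; _⊔_; _≤_; _<_; z≤n; s≤s; _<ᵇ_; _≤ᵇ_; _≡ᵇ_)
import Data.Nat.Properties as ℕₚ
open import Data.Product using (_×_; ∃; _,_)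
open import Data.Sum using (inj₁; inj₂)
open import Data.Vec as Vec using (Vec; []; _∷_; toList)
open import Function using (_∘_; id)
open import Relation.Binary.PropositionalEquality using (_≡_; refl; sym; trans; cong; cong₂; subst; module ≡-Reasoning)

-- Weights on states (L, d, m) and the transfer operator.

Weight : Set
Weight = ℕ → ℕ → ℕ → ℤ

-- The weight of the state reached from (L, d, m) by prepending the value j + 1; see State.
term : Weight → ℕ → ℕ → ℕ → ℤ
term g L zero    j = g (suc L) zero (suc j)
term g L (suc d) j = g L (d ⊓ j) (suc j)

dbl : ℕ → ℕ
dbl zero    = zero
dbl (suc n) = suc (suc (dbl n))

dbl-⊓ : ∀ m n → dbl m ⊓ dbl n ≡ dbl (m ⊓ n)
dbl-⊓ zero    n       = refl
dbl-⊓ (suc m) zero    = refl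
dbl-⊓ (suc m) (suc n) = cong (λ x → suc (suc x)) (dbl-⊓ m n)

dbl-mono-≤ : ∀ {m n} → m ≤ n → dbl m ≤ dbl n
dbl-mono-≤ z≤n     = z≤n
dbl-mono-≤ (s≤s p) = s≤s (s≤s (dbl-mono-≤ p))

module TransferOperator where
  open import Data.Integer using (_+_; _*_; _-_; -_; _^_)

  -- The exponent exceeds the index by one because index j stands for the prepended value j + 1,
  -- which adds j + 1 inversions.
  ∑ : ℤ → (ℕ → ℤ) → ℕ → ℤ
  ∑ ε f zero    = 0ℤ
  ∑ ε f (suc m) = ∑ ε f m + ε ^ suc m * f m

  -- The leading summand belongs to the prepended value 0, the sum to the values 1, ..., m.
  Δ : ℤ → Weight → Weight
  Δ ε g L d m = g (suc L) (suc d) (suc m) + ∑ ε (term g L d) m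

  ∑-cong : ∀ ε {f h} m → (∀ j → j < m → f j ≡ h j) → ∑ ε f m ≡ ∑ ε h m
  ∑-cong ε zero    f≗h = refl
  ∑-cong ε (suc m) f≗h = cong₂ _+_
    (∑-cong ε m (λ j j<m → f≗h j (ℕₚ.m<n⇒m<1+n j<m)))
    (cong (ε ^ suc m *_) (f≗h m (ℕₚ.n<1+n m)))

  Δ-cong : ∀ ε {g h} → (∀ L d m → g L d m ≡ h L d m) → ∀ L d m → Δ ε g L d m ≡ Δ ε h L d m
  Δ-cong ε {g} {h} g≗h L d m = cong₂ _+_ (g≗h _ _ _) (∑-cong ε m (λ j _ → term-cong d j))
    where
    term-cong : ∀ d j → term g L d j ≡ term h L d j
    term-cong zero    j = g≗h _ _ _
    term-cong (suc d) j = g≗h _ _ _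

  ∑₁-suc : ∀ f m → ∑ 1ℤ f (suc m) ≡ ∑ 1ℤ f m + f m
  ∑₁-suc f m = cong (∑ 1ℤ f m +_) (trans (cong (_* f m) (ℤₚ.^-zeroˡ (suc m))) (ℤₚ.*-identityˡ (f m)))

  -1^dbl : ∀ m → -1ℤ ^ dbl m ≡ 1ℤ
  -1^dbl zero    = refl
  -1^dbl (suc m) = cong (λ x → -1ℤ * (-1ℤ * x)) (-1^dbl m)

  alt : (ℕ → ℤ) → ℕ → ℤ
  alt = ∑ -1ℤ

  alt-odd : ∀ f m → alt f (suc (dbl m)) ≡ alt f (dbl m) - f (dbl m)
  alt-odd f m = cong (alt f (dbl m) +_)
    (trans (cong (λ x → -1ℤ * x * f (dbl m)) (-1^dbl m)) (ℤₚ.-1*i≡-i _))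

  alt-even : ∀ f m → alt f (dbl (suc m)) ≡ alt f (suc (dbl m)) + f (suc (dbl m))
  alt-even f m = cong (alt f (suc (dbl m)) +_)
    (trans (cong (λ x → -1ℤ * (-1ℤ * x) * f (suc (dbl m))) (-1^dbl m)) (ℤₚ.*-identityˡ _))

  module _ (g : Weight) where

    -- Raising the third argument by one exchanges the leading value and appends one summand, so the
    -- operator obeys a first-order recurrence in it.
    Δ-odd : ∀ L d m → Δ -1ℤ g L d (suc (dbl m)) ≡
      Δ -1ℤ g L d (dbl m) - g (suc L) (suc d) (suc (dbl m))
        + g (suc L) (suc d) (dbl (suc m)) - term g L d (dbl m)
    Δ-odd L d m = trans
      (cong (g (suc L) (suc d) (dbl (suc m)) +_) (alt-odd (term g L d) m))
      (lemma (g (suc L) (suc d) (suc (dbl m))) (g (suc L) (suc d) (dbl (suc m)))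
        (alt (term g L d) (dbl m)) (term g L d (dbl m)))
      where
      lemma : ∀ a b s t → b + (s - t) ≡ a + s - a + b - t
      lemma = solve-∀

    Δ-even : ∀ L d m → Δ -1ℤ g L d (dbl (suc m)) ≡
      Δ -1ℤ g L d (suc (dbl m)) - g (suc L) (suc d) (dbl (suc m))
        + g (suc L) (suc d) (suc (dbl (suc m))) + term g L d (suc (dbl m))
    Δ-even L d m = trans
      (cong (g (suc L) (suc d) (suc (dbl (suc m))) +_) (alt-even (term g L d) m))
      (lemma (g (suc L) (suc d) (dbl (suc m))) (g (suc L) (suc d) (suc (dbl (suc m))))
        (alt (term g L d) (suc (dbl m))) (term g L d (suc (dbl m))))
      where
      lemma : ∀ a b s t → b + (s + t) ≡ a + s - a + b + t
      lemma = solve-∀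

  -- Coherent weights and two steps of the signed operator.

  record Coherent (g : Weight) : Set where
    field
      zero-odd  : ∀ L m → g L 0 (suc (dbl m)) ≡ 0ℤ
      even-odd  : ∀ L e m → g L (dbl (suc e)) (suc (dbl m)) ≡ g L (suc (dbl e)) (suc (dbl m))
      even-even : ∀ L e m → g L (dbl e) (dbl m) ≡
        g (suc L) (suc (dbl e)) (dbl m) - g (suc L) (suc (dbl e)) (suc (dbl m))

  -- The summand of Δ₁ for the weight with all arguments doubled. Here `L` itself stays undoubled,
  -- so that it may carry the offset of `restrict`.
  evenTerm : Weight → ℕ → ℕ → ℕ → ℤ
  evenTerm g L zero    i = g (suc (suc L)) 0 (dbl (suc i))
  evenTerm g L (suc e) i = g L (dbl (e ⊓ i)) (dbl (suc i))

  -- If e ≤ i, both minima are attained on the left. Otherwise the argument is 2i + 2, which `f`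
  -- does not distinguish from 2i + 1.
  paired-⊓ : ∀ (f : ℕ → ℤ) → (∀ e → f (dbl (suc e)) ≡ f (suc (dbl e))) →
    ∀ e i → f (suc (dbl e) ⊓ dbl (suc i)) ≡ f (suc (dbl (e ⊓ i)))
  paired-⊓ f p zero    i       = refl
  paired-⊓ f p (suc e) zero    = p 0
  paired-⊓ f p (suc e) (suc i) = paired-⊓ (λ x → f (suc (suc x))) (λ e → p (suc e)) e i

  module Δ² {g : Weight} (coh : Coherent g) where
    open Coherent coh
    open ≡-Reasoning

    u : Weight
    u = Δ -1ℤ g

    G : Weight
    G = Δ -1ℤ u

    -- For positive i, both minima equal j when j < 2i; at the top index j = 2i the third argument
    -- is odd and `even-odd` applies. At i = 0 both sides vanish by `zero-odd`.
    term-dbl≈ : ∀ L i j → j < suc (dbl i) → term g L (suc (dbl i)) j ≡ term g L (dbl i) j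
    term-dbl≈ L zero    zero _         = trans (zero-odd L 0) (sym (zero-odd (suc L) 0))
    term-dbl≈ L zero    (suc j) (s≤s ())
    term-dbl≈ L (suc i) j j<  with ℕₚ.m≤n⇒m<n∨m≡n (ℕ.s≤s⁻¹ j<)
    ... | inj₁ (s≤s j≤) = cong (λ x → g L x (suc j))
          (trans (ℕₚ.m≥n⇒m⊓n≡n (ℕₚ.m≤n⇒m≤1+n j≤)) (sym (ℕₚ.m≥n⇒m⊓n≡n j≤)))
    ... | inj₂ refl = begin
      g L (dbl (suc i) ⊓ dbl (suc i)) (suc (dbl (suc i))) ≡⟨ cong (λ x → g L x (suc (dbl (suc i)))) (ℕₚ.⊓-idem (dbl (suc i))) ⟩
      g L (dbl (suc i)) (suc (dbl (suc i)))               ≡⟨ even-odd L i (suc i) ⟩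
      g L (suc (dbl i)) (suc (dbl (suc i)))               ≡⟨ cong (λ x → g L x (suc (dbl (suc i)))) (ℕₚ.m≤n⇒m⊓n≡m (ℕₚ.n≤1+n (suc (dbl i)))) ⟨
      g L (suc (dbl i) ⊓ dbl (suc i)) (suc (dbl (suc i))) ∎

    u-diagonal : ∀ L i → u L (dbl i) (suc (dbl i)) ≡
      u L (suc (dbl i)) (suc (dbl i)) - g (suc L) (dbl (suc i)) (dbl (suc i)) + g (suc L) (suc (dbl i)) (dbl (suc i))
    u-diagonal L i = trans
      (cong (g (suc L) (suc (dbl i)) (dbl (suc i)) +_)
        (sym (∑-cong -1ℤ (suc (dbl i)) (term-dbl≈ L i))))
      (lemma (g (suc L) (dbl (suc i)) (dbl (suc i))) (g (suc L) (suc (dbl i)) (dbl (suc i)))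
        (alt (term g L (suc (dbl i))) (suc (dbl i))))
      where
      lemma : ∀ a b s → b + s ≡ a + s - a + b
      lemma = solve-∀

    -- Two consecutive summands from each alternating sum in `terms-dbl`, taken with their signs,
    -- collapse to one summand of the unsigned sum: `Δ-even` expands the last value of `u` so that
    -- everything but that summand cancels.
    term-pair : ∀ L e i →
      term g (suc L) (suc (dbl e)) (suc (dbl i)) - term g (suc L) (suc (dbl e)) (dbl (suc i))
        - term u L (dbl e) (dbl i) + term u L (dbl e) (suc (dbl i)) ≡ evenTerm g L e i
    term-pair L zero i = begin
      g (suc L) 0 (dbl (suc i)) - g (suc L) 0 (suc (dbl (suc i))) - v + u (suc L) 0 (dbl (suc i))
        ≡⟨ cong₂ (λ x y → g (suc L) 0 (dbl (suc i)) - x - v + y)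
             (zero-odd (suc L) (suc i)) (Δ-even g (suc L) 0 i) ⟩
      g (suc L) 0 (dbl (suc i)) - 0ℤ - v + (v - a + b + t)
        ≡⟨ cong (λ x → x - 0ℤ - v + (v - a + b + t)) (even-even (suc L) 0 (suc i)) ⟩
      (a - b) - 0ℤ - v + (v - a + b + t)
        ≡⟨ lemma a b v t ⟩
      t ∎
      where
      a = g (suc (suc L)) 1 (dbl (suc i))
      b = g (suc (suc L)) 1 (suc (dbl (suc i)))
      t = g (suc (suc L)) 0 (dbl (suc i))
      v = u (suc L) 0 (suc (dbl i))
      lemma : ∀ a b v t → (a - b) - 0ℤ - v + (v - a + b + t) ≡ t
      lemma = solve-∀
    term-pair L (suc e) i with ℕₚ.≤-<-connex i e
    ... | inj₁ i≤e = begin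
      pair (suc (dbl e) ⊓ dbl i) (dbl e ⊓ dbl i)
        ≡⟨ cong₂ pair (ℕₚ.m≥n⇒m⊓n≡n (ℕₚ.m≤n⇒m≤1+n (dbl-mono-≤ i≤e))) (ℕₚ.m≥n⇒m⊓n≡n (dbl-mono-≤ i≤e)) ⟩
      a - b - u L (dbl i) (suc (dbl i)) + u L (suc (dbl i)) (dbl (suc i))
        -- The two values of `u` have second arguments 2i and 2i + 1; `u-diagonal` moves the first
        -- to 2i + 1, so that it cancels in the expansion of the second.
        ≡⟨ cong₂ (λ x y → a - b - x + y) (u-diagonal L i) (Δ-even g L (suc (dbl i)) i) ⟩
      _ ≡⟨ lemma a b (g (suc L) (dbl (suc i)) (dbl (suc i))) (u L (suc (dbl i)) (suc (dbl i)))
            (g L (dbl i ⊓ suc (dbl i)) (dbl (suc i))) ⟩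
      g L (dbl i ⊓ suc (dbl i)) (dbl (suc i))
        ≡⟨ cong (λ x → g L x (dbl (suc i))) (ℕₚ.m≤n⇒m⊓n≡m (ℕₚ.n≤1+n (dbl i))) ⟩
      g L (dbl i) (dbl (suc i))
        ≡⟨ cong (λ x → g L (dbl x) (dbl (suc i))) (ℕₚ.m≥n⇒m⊓n≡n i≤e) ⟨
      g L (dbl (e ⊓ i)) (dbl (suc i)) ∎
      where
      pair : ℕ → ℕ → ℤ
      pair x y = g (suc L) (suc x) (dbl (suc i)) - g (suc L) (suc (suc y)) (suc (dbl (suc i)))
        - u L x (suc (dbl i)) + u L (suc y) (dbl (suc i))
      a = g (suc L) (suc (dbl i)) (dbl (suc i))
      b = g (suc L) (dbl (suc i)) (suc (dbl (suc i)))
      lemma : ∀ a b c v t → a - b - (v - c + a) + (v - c + b + t) ≡ t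
      lemma = solve-∀
    ... | inj₂ e<i = begin
      pair (suc (dbl e) ⊓ dbl i) (dbl e ⊓ dbl i)
        ≡⟨ cong₂ pair (ℕₚ.m≤n⇒m⊓n≡m (ℕₚ.<⇒≤ (dbl-mono-≤ e<i))) (ℕₚ.m≤n⇒m⊓n≡m (dbl-mono-≤ (ℕₚ.<⇒≤ e<i))) ⟩
      a - b - u L (suc (dbl e)) (suc (dbl i)) + u L (suc (dbl e)) (dbl (suc i))
        ≡⟨ cong (a - b - u L (suc (dbl e)) (suc (dbl i)) +_) (Δ-even g L (suc (dbl e)) i) ⟩
      _ ≡⟨ lemma a b (u L (suc (dbl e)) (suc (dbl i))) (g L (dbl e ⊓ suc (dbl i)) (dbl (suc i))) ⟩
      g L (dbl e ⊓ suc (dbl i)) (dbl (suc i))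
        ≡⟨ cong (λ x → g L x (dbl (suc i))) (ℕₚ.m≤n⇒m⊓n≡m (ℕₚ.m≤n⇒m≤1+n (dbl-mono-≤ (ℕₚ.<⇒≤ e<i)))) ⟩
      g L (dbl e) (dbl (suc i))
        ≡⟨ cong (λ x → g L (dbl x) (dbl (suc i))) (ℕₚ.m≤n⇒m⊓n≡m (ℕₚ.<⇒≤ e<i)) ⟨
      g L (dbl (e ⊓ i)) (dbl (suc i)) ∎
      where
      pair : ℕ → ℕ → ℤ
      pair x y = g (suc L) (suc x) (dbl (suc i)) - g (suc L) (suc (suc y)) (suc (dbl (suc i)))
        - u L x (suc (dbl i)) + u L (suc y) (dbl (suc i))
      a = g (suc L) (dbl (suc e)) (dbl (suc i))
      b = g (suc L) (dbl (suc e)) (suc (dbl (suc i)))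
      lemma : ∀ a b v t → a - b - v + (v - a + b + t) ≡ t
      lemma = solve-∀

    term-zero : ∀ L e → term g L (suc (dbl e)) 0 ≡ 0ℤ
    term-zero L e = trans (cong (λ x → g L x 1) (ℕₚ.⊓-zeroʳ (dbl e))) (zero-odd L 0)

    -- The indices 1, ..., 2m for `g` and 0, ..., 2m - 1 for `u` split into the pairs of
    -- `term-pair`; index 0 for `g` contributes nothing by `term-zero`.
    terms-dbl : ∀ L e m →
      alt (term g (suc L) (suc (dbl e))) (suc (dbl m)) + alt (term u L (dbl e)) (dbl m) ≡ ∑ 1ℤ (evenTerm g L e) m
    terms-dbl L e zero = trans
      (cong (_+ 0ℤ) (alt-odd f 0)) (cong (λ x → 0ℤ - x + 0ℤ) (term-zero (suc L) e))
      where f = term g (suc L) (suc (dbl e))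
    terms-dbl L e (suc m) = begin
      alt f (suc (dbl (suc m))) + alt h (dbl (suc m))
        ≡⟨ cong₂ _+_ (trans (alt-odd f (suc m)) (cong (_- f (dbl (suc m))) (alt-even f m)))
                     (trans (alt-even h m) (cong (_+ h (suc (dbl m))) (alt-odd h m))) ⟩
      _ ≡⟨ lemma (alt f (suc (dbl m))) (f (suc (dbl m))) (f (dbl (suc m))) (alt h (dbl m)) (h (dbl m)) (h (suc (dbl m))) ⟩
      alt f (suc (dbl m)) + alt h (dbl m) + (f (suc (dbl m)) - f (dbl (suc m)) - h (dbl m) + h (suc (dbl m)))
        ≡⟨ cong₂ _+_ (terms-dbl L e m) (term-pair L e m) ⟩
      ∑ 1ℤ (evenTerm g L e) m + evenTerm g L e m ≡⟨ ∑₁-suc (evenTerm g L e) m ⟨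
      ∑ 1ℤ (evenTerm g L e) (suc m) ∎
      where
      f = term g (suc L) (suc (dbl e))
      h = term u L (dbl e)
      lemma : ∀ s a b t c d → s + a - b + (t - c + d) ≡ s + t + (a - b - c + d)
      lemma = solve-∀

    G-dbl : ∀ L e m → G L (dbl e) (dbl m) ≡
      g (suc (suc L)) (dbl (suc e)) (dbl (suc m)) + ∑ 1ℤ (evenTerm g L e) m
    G-dbl L e m = trans (ℤₚ.+-assoc a _ _) (cong (a +_) (terms-dbl L e m))
      where a = g (suc (suc L)) (dbl (suc e)) (dbl (suc m))

    column : ℕ → ℕ → ℕ → ℤ
    column L i d = g L d (suc (dbl i))

    -- For positive e and i the second arguments on the two sides lie in one pair {2k - 1, 2k}, on
    -- which `even-odd` makes the column constant.
    odd-column : ∀ L e i → g L (dbl e ⊓ dbl i) (suc (dbl i)) ≡ term g L (dbl e) (dbl i)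
    odd-column L zero    i       = trans (zero-odd L i) (sym (zero-odd (suc L) i))
    odd-column L (suc e) zero    = refl
    odd-column L (suc e) (suc i) = begin
      column L (suc i) (dbl (suc e) ⊓ dbl (suc i)) ≡⟨ cong (column L (suc i)) (dbl-⊓ (suc e) (suc i)) ⟩
      column L (suc i) (dbl (suc (e ⊓ i)))         ≡⟨ even-odd L (e ⊓ i) (suc i) ⟩
      column L (suc i) (suc (dbl (e ⊓ i)))         ≡⟨ paired-⊓ (column L (suc i)) (λ d → even-odd L d (suc i)) e i ⟨
      column L (suc i) (suc (dbl e) ⊓ dbl (suc i)) ∎

    -- If m < e, all minima are decided by the index and the sides coincide. If e ≤ m, the second
    -- argument of `u` is 2e + 1 on the left and 2e on the right; `Δ-odd` reduces both sides to
    -- values of `g` with odd third argument, which `even-odd` and `odd-column` compare.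
    terms-odd-pair : ∀ L e m →
      term g (suc L) (suc (dbl (suc e))) (suc (dbl (suc m)))
        + (term u L (dbl (suc e)) (suc (dbl m)) - term u L (dbl (suc e)) (dbl (suc m))) ≡
      term g (suc L) (dbl (suc e)) (suc (dbl (suc m)))
        + (term u L (suc (dbl e)) (suc (dbl m)) - term u L (suc (dbl e)) (dbl (suc m)))
    terms-odd-pair L e m with ℕₚ.<-≤-connex m e
    ... | inj₁ m<e = cong₂ _+_
        (cong (λ x → g (suc L) (suc x) (dbl (suc (suc m)))) (trans (⊓₁ 1) (sym (⊓₁ 0))))
        (cong₂ (λ x y → u L x (dbl (suc m)) - u L y (suc (dbl (suc m))))
          (trans (⊓₂ 1) (sym (⊓₂ 0))) (trans (⊓₁ 1) (sym (⊓₁ 0))))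
      where
      ⊓₁ : ∀ k → (k ℕ.+ dbl e) ⊓ dbl (suc m) ≡ dbl (suc m)
      ⊓₁ k = ℕₚ.m≥n⇒m⊓n≡n (ℕₚ.m≤n⇒m≤o+n k (dbl-mono-≤ m<e))
      ⊓₂ : ∀ k → (k ℕ.+ dbl e) ⊓ suc (dbl m) ≡ suc (dbl m)
      ⊓₂ k = ℕₚ.m≥n⇒m⊓n≡n (ℕₚ.m≤n⇒m≤o+n k (ℕₚ.<⇒≤ (dbl-mono-≤ m<e)))
    ... | inj₂ e≤m = begin
      pair (suc (dbl e) ⊓ dbl (suc m)) (dbl e ⊓ dbl m) (suc (dbl e) ⊓ dbl (suc m))
        ≡⟨ cong₂ (λ x y → pair x y x) ⊓₁ (ℕₚ.m≤n⇒m⊓n≡m (dbl-mono-≤ e≤m)) ⟩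
      a + (u L (suc (dbl e)) (dbl (suc m)) - u L (suc (dbl e)) (suc (dbl (suc m))))
        ≡⟨ cong (λ x → a + (u L (suc (dbl e)) (dbl (suc m)) - x)) (Δ-odd g L (suc (dbl e)) (suc m)) ⟩
      _ ≡⟨ lemma a (u L (suc (dbl e)) (dbl (suc m))) (g (suc L) (dbl (suc e)) (suc (dbl (suc m))))
            (g L (dbl e ⊓ dbl (suc m)) (suc (dbl (suc m)))) ⟩
      g (suc L) (dbl (suc e)) (suc (dbl (suc m))) + g L (dbl e ⊓ dbl (suc m)) (suc (dbl (suc m)))
        ≡⟨ cong₂ _+_ (even-odd (suc L) e (suc m)) (odd-column L e (suc m)) ⟩
      g (suc L) (suc (dbl e)) (suc (dbl (suc m))) + term g L (dbl e) (dbl (suc m))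
        ≡⟨ lemma b (u L (dbl e) (dbl (suc m))) (g (suc L) (suc (dbl e)) (suc (dbl (suc m))))
             (term g L (dbl e) (dbl (suc m))) ⟨
      _ ≡⟨ cong (λ x → b + (u L (dbl e) (dbl (suc m)) - x)) (Δ-odd g L (dbl e) (suc m)) ⟨
      b + (u L (dbl e) (dbl (suc m)) - u L (dbl e) (suc (dbl (suc m))))
        ≡⟨ cong₂ (λ x y → g (suc L) (suc x) (dbl (suc (suc m))) + (u L y (dbl (suc m)) - u L x (suc (dbl (suc m)))))
             ⊓₂ (ℕₚ.m≤n⇒m⊓n≡m (ℕₚ.m≤n⇒m≤1+n (dbl-mono-≤ e≤m))) ⟨
      _ ∎
      where
      pair : ℕ → ℕ → ℕ → ℤ
      pair x y z = g (suc L) (suc x) (dbl (suc (suc m))) + (u L (suc y) (dbl (suc m)) - u L z (suc (dbl (suc m))))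
      ⊓₁ : suc (dbl e) ⊓ dbl (suc m) ≡ suc (dbl e)
      ⊓₁ = ℕₚ.m≤n⇒m⊓n≡m (ℕₚ.m≤n⇒m≤1+n (s≤s (dbl-mono-≤ e≤m)))
      ⊓₂ : dbl e ⊓ dbl (suc m) ≡ dbl e
      ⊓₂ = ℕₚ.m≤n⇒m⊓n≡m (ℕₚ.m≤n⇒m≤1+n (ℕₚ.m≤n⇒m≤1+n (dbl-mono-≤ e≤m)))
      a = g (suc L) (dbl (suc e)) (dbl (suc (suc m)))
      b = g (suc L) (suc (dbl e)) (dbl (suc (suc m)))
      lemma : ∀ a v c t → a + (v - (v - c + a - t)) ≡ c + t
      lemma = solve-∀

    terms-odd : ∀ L e m →
      alt (term g (suc L) (suc (dbl (suc e)))) (dbl (suc m)) + alt (term u L (dbl (suc e))) (suc (dbl m)) ≡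
      alt (term g (suc L) (dbl (suc e))) (dbl (suc m)) + alt (term u L (suc (dbl e))) (suc (dbl m))
    terms-odd L e = by-pairs
      where
      f = term g (suc L) (suc (dbl (suc e)))
      f′ = term g (suc L) (dbl (suc e))
      h = term u L (dbl (suc e))
      h′ = term u L (suc (dbl e))
      -- Two summands leave each sum at once. The isolated value of `p` is matched by `odd-column`,
      -- the other three by `terms-odd-pair`.
      expand : ∀ p q m → alt p (dbl (suc (suc m))) + alt q (suc (dbl (suc m))) ≡
        (alt p (dbl (suc m)) + alt q (suc (dbl m)) - p (dbl (suc m)))
          + (p (suc (dbl (suc m))) + (q (suc (dbl m)) - q (dbl (suc m))))
      expand p q m = trans
        (cong₂ _+_ (trans (alt-even p (suc m)) (cong (_+ p (suc (dbl (suc m)))) (alt-odd p (suc m))))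
                   (trans (alt-odd q (suc m)) (cong (_- q (dbl (suc m))) (alt-even q m))))
        (lemma (alt p (dbl (suc m))) (p (dbl (suc m))) (p (suc (dbl (suc m))))
               (alt q (suc (dbl m))) (q (suc (dbl m))) (q (dbl (suc m))))
        where
        lemma : ∀ s a b t c d → s - a + b + (t + c - d) ≡ (s + t - a) + (b + (c - d))
        lemma = solve-∀
      by-pairs : ∀ m → alt f (dbl (suc m)) + alt h (suc (dbl m)) ≡ alt f′ (dbl (suc m)) + alt h′ (suc (dbl m))
      -- The two sides compute to this expression at `x = 0` and at `x = dbl e ⊓ 0`; the latter is
      -- stuck while `e` is a variable.
      by-pairs zero = cong (λ x → alt (λ { 0 → g (suc L) 0 1 ; _ → g (suc L) (suc x) 2 }) 2 + alt (λ _ → u L x 1) 1)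
        (sym (ℕₚ.⊓-zeroʳ (dbl e)))
      by-pairs (suc m) = begin
        _ ≡⟨ expand f h m ⟩
        _ ≡⟨ cong₂ _+_ (cong₂ _-_ (by-pairs m) (odd-column (suc L) (suc e) (suc m))) (terms-odd-pair L e m) ⟩
        _ ≡⟨ expand f′ h′ m ⟨
        _ ∎

    term-even-pair : ∀ L e i → term g (suc L) (dbl e) (suc (dbl i)) - term g (suc L) (dbl e) (dbl (suc i)) ≡ evenTerm g L e i
    term-even-pair L zero i = trans
      (cong (λ x → g (suc (suc L)) 0 (dbl (suc i)) - x) (zero-odd (suc (suc L)) (suc i)))
      (ℤₚ.+-identityʳ (g (suc (suc L)) 0 (dbl (suc i))))
    term-even-pair L (suc e) i = begin
      g (suc L) (suc (dbl e ⊓ dbl i)) (dbl (suc i)) - column (suc L) (suc i) (suc (dbl e) ⊓ dbl (suc i))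
        ≡⟨ cong₂ (λ x y → g (suc L) (suc x) (dbl (suc i)) - y) (dbl-⊓ e i)
             (paired-⊓ (column (suc L) (suc i)) (λ d → even-odd (suc L) d (suc i)) e i) ⟩
      g (suc L) (suc (dbl (e ⊓ i))) (dbl (suc i)) - column (suc L) (suc i) (suc (dbl (e ⊓ i)))
        ≡⟨ even-even L (e ⊓ i) (suc i) ⟨
      g L (dbl (e ⊓ i)) (dbl (suc i)) ∎

    -- The pairing of `terms-dbl`, now with `even-even` collapsing each pair. Comparing the two
    -- lemmas yields `zero-odd` for `G`; `terms-⊓` carries this one over to `even-even` for `G`.
    terms-even : ∀ L e i → alt (term g (suc L) (dbl e)) (suc (dbl i)) ≡ ∑ 1ℤ (evenTerm g L e) i
    terms-even L e zero = trans (alt-odd (term g (suc L) (dbl e)) 0) (cong (λ x → 0ℤ - x) (first e))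
      where
      first : ∀ e → term g (suc L) (dbl e) 0 ≡ 0ℤ
      first zero    = zero-odd (suc (suc L)) 0
      first (suc e) = zero-odd (suc L) 0
    terms-even L e (suc i) = begin
      alt f (suc (dbl (suc i)))
        ≡⟨ trans (alt-odd f (suc i)) (cong (_- f (dbl (suc i))) (alt-even f i)) ⟩
      alt f (suc (dbl i)) + f (suc (dbl i)) - f (dbl (suc i))
        ≡⟨ ℤₚ.+-assoc (alt f (suc (dbl i))) (f (suc (dbl i))) (- f (dbl (suc i))) ⟩
      alt f (suc (dbl i)) + (f (suc (dbl i)) - f (dbl (suc i)))
        ≡⟨ cong₂ _+_ (terms-even L e i) (term-even-pair L e i) ⟩
      ∑ 1ℤ (evenTerm g L e) i + evenTerm g L e i ≡⟨ ∑₁-suc (evenTerm g L e) i ⟨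
      ∑ 1ℤ (evenTerm g L e) (suc i) ∎
      where f = term g (suc L) (dbl e)

    -- Every index l is below i, so cutting e down to min(e, i) leaves each minimum with l
    -- unchanged.
    terms-⊓ : ∀ L e i → alt (term g (suc L) (dbl e ⊓ dbl i)) (suc (dbl i)) ≡ ∑ 1ℤ (evenTerm g L e) i
    terms-⊓ L e i = begin
      alt (term g (suc L) (dbl e ⊓ dbl i)) (suc (dbl i)) ≡⟨ cong (λ x → alt (term g (suc L) x) (suc (dbl i))) (dbl-⊓ e i) ⟩
      alt (term g (suc L) (dbl (e ⊓ i))) (suc (dbl i))   ≡⟨ terms-even L (e ⊓ i) i ⟩
      ∑ 1ℤ (evenTerm g L (e ⊓ i)) i                         ≡⟨ ∑-cong 1ℤ i (cut e i) ⟩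
      ∑ 1ℤ (evenTerm g L e) i                               ∎
      where
      cut : ∀ e i l → l < i → evenTerm g L (e ⊓ i) l ≡ evenTerm g L e l
      cut zero    i       l l<i       = refl
      cut (suc e) (suc i) l (s≤s l≤i) = cong (λ x → g L (dbl x) (dbl (suc l)))
        (trans (ℕₚ.⊓-assoc e i l) (cong (e ⊓_) (ℕₚ.m≥n⇒m⊓n≡n l≤i)))

    coherent : Coherent G
    coherent .Coherent.zero-odd L m = begin
      (g (suc (suc L)) 2 (suc (dbl (suc m))) + alt f (dbl (suc m))) + alt h (suc (dbl m))
        ≡⟨ cong₂ _+_
             (cong₂ _+_ (even-odd (suc (suc L)) 0 (suc m))
               (trans (alt-even f m) (cong (alt f (suc (dbl m)) +_) (even-even (suc L) 0 (suc m)))))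
             -- The last summand of `h` is a value of `u`; its alternating sum equals, by
             -- `terms-even` and `terms-dbl`, the two partial sums already present, which then
             -- cancel.
             (trans (alt-odd h m) (cong (λ x → alt h (dbl m) - (a + x))
               (trans (terms-even L 0 m) (sym (terms-dbl L 0 m))))) ⟩
      (b + (alt f (suc (dbl m)) + (a - b))) + (alt h (dbl m) - (a + (alt f (suc (dbl m)) + alt h (dbl m))))
        ≡⟨ lemma a b (alt f (suc (dbl m))) (alt h (dbl m)) ⟩
      0ℤ ∎
      where
      f = term g (suc L) 1
      h = term u L 0
      a = g (suc (suc L)) 1 (dbl (suc m))
      b = g (suc (suc L)) 1 (suc (dbl (suc m)))
      lemma : ∀ a b s t → (b + (s + (a - b))) + (t - (a + (s + t))) ≡ 0ℤ
      lemma = solve-∀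
    coherent .Coherent.even-odd L e m = begin
      (a + s) + t   ≡⟨ ℤₚ.+-assoc a s t ⟩
      a + (s + t)   ≡⟨ cong₂ _+_ (even-odd (suc (suc L)) (suc e) (suc m)) (terms-odd L e m) ⟩
      b + (s′ + t′) ≡⟨ ℤₚ.+-assoc b s′ t′ ⟨
      (b + s′) + t′ ∎
      where
      a = g (suc (suc L)) (dbl (suc (suc e))) (suc (dbl (suc m)))
      b = g (suc (suc L)) (suc (dbl (suc e))) (suc (dbl (suc m)))
      s = alt (term g (suc L) (suc (dbl (suc e)))) (dbl (suc m))
      t = alt (term u L (dbl (suc e))) (suc (dbl m))
      s′ = alt (term g (suc L) (dbl (suc e))) (dbl (suc m))
      t′ = alt (term u L (suc (dbl e))) (suc (dbl m))
    coherent .Coherent.even-even L e i = begin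
      G L (dbl e) (dbl i)
        ≡⟨ G-dbl L e i ⟩
      g (suc (suc L)) (dbl (suc e)) (dbl (suc i)) + ∑ 1ℤ (evenTerm g L e) i
        ≡⟨ cong₂ _+_ (even-even (suc (suc L)) (suc e) (suc i)) (sym (terms-⊓ L e i)) ⟩
      (p - q) + s
        -- Read upwards from the goal: `Δ-odd` for `u` appends a value of `u` that unfolds to
        -- `r + s`, and `Δ-even` for `g` appends another `r`, which cancels the first.
        ≡⟨ lemma p q s r x w ⟨
      w - (w - x + (x - p + q + r) - (r + s))
        ≡⟨ cong (λ y → w - (w - x + y - (r + s))) (Δ-even g (suc (suc L)) (dbl (suc e)) i) ⟨
      w - (w - x + u (suc (suc L)) (dbl (suc e)) (dbl (suc i)) - (r + s))
        ≡⟨ cong (λ y → w - y) (Δ-odd u (suc L) (suc (dbl e)) i) ⟨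
      w - G (suc L) (suc (dbl e)) (suc (dbl i)) ∎
      where
      p = g (suc (suc (suc L))) (suc (dbl (suc e))) (dbl (suc i))
      q = g (suc (suc (suc L))) (suc (dbl (suc e))) (suc (dbl (suc i)))
      r = g (suc (suc L)) (suc (dbl e ⊓ dbl i)) (dbl (suc i))
      s = alt (term g (suc L) (dbl e ⊓ dbl i)) (suc (dbl i))
      w = G (suc L) (suc (dbl e)) (dbl i)
      x = u (suc (suc L)) (dbl (suc e)) (suc (dbl i))
      lemma : ∀ p q s r x w → w - (w - x + (x - p + q + r) - (r + s)) ≡ (p - q) + s
      lemma = solve-∀

  -- Iterates of the operator and the two identities at the empty word.

  iter : ℤ → ℕ → Weight → Weight
  iter ε zero    g = g
  iter ε (suc n) g = iter ε n (Δ ε g)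

  iter-cong : ∀ ε n {g h} → (∀ L d m → g L d m ≡ h L d m) → ∀ L d m → iter ε n g L d m ≡ iter ε n h L d m
  iter-cong ε zero    g≗h = g≗h
  iter-cong ε (suc n) g≗h = iter-cong ε n (Δ-cong ε g≗h)

  iter-Δ : ∀ ε n g L d m → iter ε n (Δ ε g) L d m ≡ Δ ε (iter ε n g) L d m
  iter-Δ ε zero    g L d m = refl
  iter-Δ ε (suc n) g L d m = iter-Δ ε n (Δ ε g) L d m

  -- Two signed steps raise the first argument by 0 or 2 and so preserve the offset `c` from an even
  -- number. The odd case uses offset 0, the even case the difference of offsets 1 and 0.
  restrict : ℕ → Weight → Weight
  restrict c g L d m = g (dbl L ℕ.+ c) (dbl d) (dbl m)

  restrict-Δ² : ∀ c {g} → Coherent g → ∀ L d m →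
    restrict c (Δ -1ℤ (Δ -1ℤ g)) L d m ≡ Δ 1ℤ (restrict c g) L d m
  restrict-Δ² c {g} coh L d m = trans (Δ².G-dbl coh (dbl L ℕ.+ c) d m)
    (cong (g (dbl (suc L) ℕ.+ c) (dbl (suc d)) (dbl (suc m)) +_) (∑-cong 1ℤ m (λ j _ → term-restrict d j)))
    where
    term-restrict : ∀ d j → evenTerm g (dbl L ℕ.+ c) d j ≡ term (restrict c g) L d j
    term-restrict zero    j = refl
    term-restrict (suc d) j = refl

  restrict-iter : ∀ c n {g} → Coherent g → ∀ L d m →
    restrict c (iter -1ℤ (dbl n) g) L d m ≡ iter 1ℤ n (restrict c g) L d m
  restrict-iter c zero    coh L d m = refl
  restrict-iter c (suc n) coh L d m = trans
    (restrict-iter c n (Δ².coherent coh) L d m)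
    (iter-cong 1ℤ n (restrict-Δ² c coh) L d m)

  coherent-iter : ∀ n {g} → Coherent g → Coherent (iter -1ℤ (dbl n) g)
  coherent-iter zero    coh = coh
  coherent-iter (suc n) coh = coherent-iter n (Δ².coherent coh)

  -- States have d ≤ m, but the relation even-even at (0, 0, 0) involves the non-state (1, 1, 0).
  Saturated : Weight → Set
  Saturated g = ∀ L d m → m ≤ d → g L (suc d) m ≡ g L d m

  -- Each index j satisfies j < m ≤ d, so the minimum in `term` is j for both second arguments.
  saturated-Δ : ∀ ε {g} → Saturated g → Saturated (Δ ε g)
  saturated-Δ ε {g} sat L d m m≤d = cong₂ _+_ (sat (suc L) (suc d) (suc m) (s≤s m≤d))
    (∑-cong ε m (λ j j<m → term-sat d j (ℕₚ.<-≤-trans j<m m≤d)))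
    where
    term-sat : ∀ d j → j < d → term g L (suc d) j ≡ term g L d j
    term-sat (suc d) j (s≤s j≤d) = cong (λ x → g L x (suc j))
      (trans (ℕₚ.m≥n⇒m⊓n≡n (ℕₚ.m≤n⇒m≤1+n j≤d)) (sym (ℕₚ.m≥n⇒m⊓n≡n j≤d)))

  saturated-iter : ∀ ε n {g} → Saturated g → Saturated (iter ε n g)
  saturated-iter ε zero    sat = sat
  saturated-iter ε (suc n) sat = saturated-iter ε n (saturated-Δ ε sat)

  ofLis : (ℕ → ℤ) → Weight
  ofLis h L d m = h L

  module _ (h : ℕ → ℤ) where

    alt-const-odd : ∀ x m → alt (λ _ → x) (suc (dbl m)) ≡ - x
    alt-const-even : ∀ x m → alt (λ _ → x) (dbl m) ≡ 0ℤ
    alt-const-odd x m = trans (alt-odd (λ _ → x) m) (trans (cong (_- x) (alt-const-even x m)) (ℤₚ.+-identityˡ (- x)))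
    alt-const-even x zero = refl
    alt-const-even x (suc m) = trans (alt-even (λ _ → x) m) (trans (cong (_+ x) (alt-const-odd x m)) (ℤₚ.+-inverseˡ x))

    Δ-ofLis-even : ∀ L d m → Δ -1ℤ (ofLis h) L d (dbl m) ≡ h (suc L)
    Δ-ofLis-even L zero m = trans (cong (h (suc L) +_) (alt-const-even (h (suc L)) m)) (ℤₚ.+-identityʳ (h (suc L)))
    Δ-ofLis-even L (suc d) m = trans (cong (h (suc L) +_) (alt-const-even (h L) m)) (ℤₚ.+-identityʳ (h (suc L)))

    -- All summands equal h(L + 1) if d = 0 and h(L) if d > 0; their alternating sum is 0 over an
    -- even range and minus that constant over an odd one.
    coherent-Δ-ofLis : Coherent (Δ -1ℤ (ofLis h))
    coherent-Δ-ofLis .Coherent.zero-odd L m =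
      trans (cong (h (suc L) +_) (alt-const-odd (h (suc L)) m)) (ℤₚ.+-inverseʳ (h (suc L)))
    coherent-Δ-ofLis .Coherent.even-odd L e m = refl
    coherent-Δ-ofLis .Coherent.even-even L e m = begin
      Δ -1ℤ (ofLis h) L (dbl e) (dbl m) ≡⟨ Δ-ofLis-even L (dbl e) m ⟩
      h (suc L) ≡⟨ lemma (h (suc (suc L))) (h (suc L)) ⟨
      h (suc (suc L)) - (h (suc (suc L)) - h (suc L))
        ≡⟨ cong₂ _-_ (Δ-ofLis-even (suc L) (suc (dbl e)) m) (cong (h (suc (suc L)) +_) (alt-const-odd (h (suc L)) m)) ⟨
      _ ∎
      where
      open ≡-Reasoning
      lemma : ∀ a b → a - (a - b) ≡ b
      lemma = solve-∀

    -- The first signed step supplies coherence and replaces h(L) by h(L + 1) at even arguments; the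
    -- other 2n steps become n unsigned ones.
    iter-restrict : ∀ c n → iter -1ℤ (suc (dbl n)) (ofLis h) c 0 0 ≡ iter 1ℤ n (ofLis (λ L → h (suc (dbl L ℕ.+ c)))) 0 0 0
    iter-restrict c n = trans (restrict-iter c n coherent-Δ-ofLis 0 0 0)
      (iter-cong 1ℤ n (λ L d m → Δ-ofLis-even (dbl L ℕ.+ c) (dbl d) m) 0 0 0)

    iter-even : ∀ n → iter -1ℤ (dbl (suc n)) (ofLis h) 0 0 0 ≡
      iter 1ℤ n (ofLis (λ L → h (suc (dbl L ℕ.+ 1)))) 0 0 0 - iter 1ℤ n (ofLis (λ L → h (suc (dbl L ℕ.+ 0)))) 0 0 0
    iter-even n = begin
      iter -1ℤ (dbl (suc n)) (ofLis h) 0 0 0 ≡⟨ iter-Δ -1ℤ (dbl n) (Δ -1ℤ (ofLis h)) 0 0 0 ⟩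
      -- At m = 0 the sum in the last step is empty. The value g 1 1 0 is inserted so that
      -- `even-even` applies at (0, 0, 0).
      g 1 1 1 + 0ℤ                           ≡⟨ lemma (g 1 1 1) (g 1 1 0) ⟩
      g 1 1 0 - (g 1 1 0 - g 1 1 1)          ≡⟨ cong₂ _-_ sat (sym (Coherent.even-even coh 0 0 0)) ⟩
      g 1 0 0 - g 0 0 0                      ≡⟨ cong₂ _-_ (iter-restrict 1 n) (iter-restrict 0 n) ⟩
      _ ∎
      where
      open ≡-Reasoning
      g = iter -1ℤ (suc (dbl n)) (ofLis h)
      coh = coherent-iter n coherent-Δ-ofLis
      sat = saturated-iter -1ℤ (suc (dbl n)) {ofLis h} (λ _ _ _ _ → refl) 1 0 0 z≤n
      lemma : ∀ a b → a + 0ℤ ≡ b - (b - a)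
      lemma = solve-∀

-- Recursive forms of `lis` and of the avoidance test.

-- The longest increasing subsequence with all entries at least `j`; prepending `r` requires this
-- quantity at threshold `r`.
lisFrom : ℕ → List ℕ → ℕ
lisFrom j []      = 0
lisFrom j (x ∷ w) = if j ≤ᵇ x then suc (lisFrom (suc x) w) ⊔ lisFrom j w else lisFrom j w

-- decBelow k b w: w has a decreasing subsequence of length k with all entries less than b.
decBelow : ℕ → ℕ → List ℕ → Bool
decBelow zero    b w       = true
decBelow (suc k) b []      = false
decBelow (suc k) b (x ∷ w) = ((x <ᵇ b) ∧ decBelow k x w) ∨ decBelow (suc k) b w

has321 : List ℕ → Bool
has321 []      = false
has321 (x ∷ w) = decBelow 2 x w ∨ has321 w

below : ℕ → List ℕ → ℕ
below b w = length (filterᵇ (_<ᵇ b) w)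

-- With the bound carried explicitly, filtering `subseqs` follows the same recursion as `lisFrom`.
incFrom : ℕ → List ℕ → Bool
incFrom j []      = true
incFrom j (x ∷ s) = (j ≤ᵇ x) ∧ incFrom (suc x) s

increasing-∷ : ∀ x s → increasingᵇ (x ∷ s) ≡ incFrom (suc x) s
increasing-∷ x []      = refl
increasing-∷ x (y ∷ s) = cong ((x <ᵇ y) ∧_) (increasing-∷ y s)

increasing≗incFrom : ∀ s → increasingᵇ s ≡ incFrom 0 s
increasing≗incFrom []      = refl
increasing≗incFrom (x ∷ s) = increasing-∷ x s

filterᵇ-cong : ∀ {A : Set} {p q : A → Bool} → (∀ x → p x ≡ q x) → ∀ xs → filterᵇ p xs ≡ filterᵇ q xs
filterᵇ-cong p≗q []       = refl
filterᵇ-cong {q = q} p≗q (x ∷ xs) rewrite p≗q x with q x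
... | true  = cong (x ∷_) (filterᵇ-cong p≗q xs)
... | false = filterᵇ-cong p≗q xs

filterᵇ-incFrom-∷ : ∀ j x ss → filterᵇ (incFrom j) (map (x ∷_) ss) ≡
  (if j ≤ᵇ x then map (x ∷_) (filterᵇ (incFrom (suc x)) ss) else [])
filterᵇ-incFrom-∷ j x [] with j ≤ᵇ x
... | true  = refl
... | false = refl
filterᵇ-incFrom-∷ j x (s ∷ ss) with filterᵇ-incFrom-∷ j x ss
... | ih with j ≤ᵇ x
...   | false = ih
...   | true with incFrom (suc x) s
...     | true  = cong ((x ∷ s) ∷_) ih
...     | false = ih

increasings : ℕ → List ℕ → List (List ℕ)
increasings j w = filterᵇ (incFrom j) (subseqs w)

increasings-∷ : ∀ j x w → increasings j (x ∷ w) ≡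
  (if j ≤ᵇ x then map (x ∷_) (increasings (suc x) w) else []) ++ increasings j w
increasings-∷ j x w = trans
  (Listₚ.filter-++ (Boolₚ.T? ∘ incFrom j) (map (x ∷_) (subseqs w)) (subseqs w))
  (cong (_++ increasings j w) (filterᵇ-incFrom-∷ j x (subseqs w)))

-- The empty subsequence comes last, so the maximum commutes with suc.
increasings-nonempty : ∀ j w → ∃ λ ss → increasings j w ≡ ss ++ [] ∷ []
increasings-nonempty j [] = [] , refl
increasings-nonempty j (x ∷ w) with increasings-nonempty j w
... | ss , eq = xs ++ ss , trans (increasings-∷ j x w) (trans (cong (xs ++_) eq) (sym (Listₚ.++-assoc xs ss _)))
  where xs = if j ≤ᵇ x then map (x ∷_) (increasings (suc x) w) else []

maxLength : List (List ℕ) → ℕ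
maxLength ss = foldr _⊔_ 0 (map length ss)

maxLength-++ : ∀ ss ts → maxLength (ss ++ ts) ≡ maxLength ss ⊔ maxLength ts
maxLength-++ []       ts = refl
maxLength-++ (s ∷ ss) ts = trans (cong (length s ⊔_) (maxLength-++ ss ts)) (sym (ℕₚ.⊔-assoc (length s) _ _))

maxLength-∷ : ∀ x ss → maxLength (map (x ∷_) (ss ++ [] ∷ [])) ≡ suc (maxLength (ss ++ [] ∷ []))
maxLength-∷ x []       = refl
maxLength-∷ x (s ∷ ss) = cong (suc (length s) ⊔_) (maxLength-∷ x ss)

maxLength-increasings : ∀ j w → maxLength (increasings j w) ≡ lisFrom j w
maxLength-increasings j []      = refl
maxLength-increasings j (x ∷ w) = trans (cong maxLength (increasings-∷ j x w)) split
  where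
  split : maxLength ((if j ≤ᵇ x then map (x ∷_) (increasings (suc x) w) else []) ++ increasings j w)
    ≡ lisFrom j (x ∷ w)
  split with j ≤ᵇ x
  ... | false = maxLength-increasings j w
  ... | true  = trans (maxLength-++ (map (x ∷_) (increasings (suc x) w)) (increasings j w))
    (cong₂ _⊔_ (trans (longer (increasings-nonempty (suc x) w)) (cong suc (maxLength-increasings (suc x) w)))
               (maxLength-increasings j w))
    where
    longer : (∃ λ ss → increasings (suc x) w ≡ ss ++ [] ∷ []) →
      maxLength (map (x ∷_) (increasings (suc x) w)) ≡ suc (maxLength (increasings (suc x) w))
    longer (ss , eq) rewrite eq = maxLength-∷ x ss

lis≡lisFrom : ∀ {n} (v : Vec (Fin n) n) → lis v ≡ lisFrom 0 (oneLine v)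
lis≡lisFrom v = trans (cong maxLength (filterᵇ-cong increasing≗incFrom (subseqs (oneLine v))))
  (maxLength-increasings 0 (oneLine v))

decFrom : ℕ → List ℕ → Bool
decFrom b []      = true
decFrom b (x ∷ s) = (x <ᵇ b) ∧ decFrom x s

decreasing-∷ : ∀ x s → decreasingᵇ (x ∷ s) ≡ decFrom x s
decreasing-∷ x []      = refl
decreasing-∷ x (y ∷ s) = cong ((y <ᵇ x) ∧_) (decreasing-∷ y s)

any-++ : ∀ {A : Set} (p : A → Bool) xs ys → any p (xs ++ ys) ≡ any p xs ∨ any p ys
any-++ p []       ys = refl
any-++ p (x ∷ xs) ys = trans (cong (p x ∨_) (any-++ p xs ys)) (sym (Boolₚ.∨-assoc (p x) _ _))

any-map : ∀ {A B : Set} (p : B → Bool) (f : A → B) xs → any p (map f xs) ≡ any (p ∘ f) xs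
any-map p f xs = cong or (sym (Listₚ.map-∘ xs))

any-cong : ∀ {A : Set} {p q : A → Bool} → (∀ x → p x ≡ q x) → ∀ xs → any p xs ≡ any q xs
any-cong p≗q xs = cong or (Listₚ.map-cong p≗q xs)

any-∧ : ∀ {A : Set} c (p : A → Bool) xs → any (λ x → c ∧ p x) xs ≡ c ∧ any p xs
any-∧ c p []       = sym (Boolₚ.∧-zeroʳ c)
any-∧ c p (x ∷ xs) = trans (cong ((c ∧ p x) ∨_) (any-∧ c p xs)) (sym (Boolₚ.∧-distribˡ-∨ c (p x) (any p xs)))

any-false : ∀ {A : Set} (xs : List A) → any (λ _ → false) xs ≡ false
any-false []       = refl
any-false (x ∷ xs) = any-false xs

any-subseqs-∷ : ∀ p x w → any p (subseqs (x ∷ w)) ≡ any (λ s → p (x ∷ s)) (subseqs w) ∨ any p (subseqs w)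
any-subseqs-∷ p x w = trans (any-++ p (map (x ∷_) (subseqs w)) (subseqs w))
  (cong (_∨ any p (subseqs w)) (any-map p (x ∷_) (subseqs w)))

any-decFrom : ∀ k b w → any (λ s → (length s ≡ᵇ k) ∧ decFrom b s) (subseqs w) ≡ decBelow k b w
any-decFrom zero    b []      = refl
any-decFrom (suc k) b []      = refl
any-decFrom zero    b (x ∷ w) = trans (any-subseqs-∷ _ x w)
  (cong₂ _∨_ (any-false (subseqs w)) (any-decFrom zero b w))
any-decFrom (suc k) b (x ∷ w) = trans (any-subseqs-∷ _ x w) (cong₂ _∨_
  (trans (any-cong (λ s → swap (length s ≡ᵇ k) (x <ᵇ b) (decFrom x s)) (subseqs w))
    (trans (any-∧ (x <ᵇ b) _ (subseqs w)) (cong ((x <ᵇ b) ∧_) (any-decFrom k x w))))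
  (any-decFrom (suc k) b w))
  where
  swap : ∀ a c d → a ∧ (c ∧ d) ≡ c ∧ (a ∧ d)
  swap true  c d = refl
  swap false c d = sym (Boolₚ.∧-zeroʳ c)

avoids321≡ : ∀ w → avoids321ᵇ w ≡ not (has321 w)
avoids321≡ w = cong not (contains w)
  where
  contains : ∀ w → any (λ s → (length s ≡ᵇ 3) ∧ decreasingᵇ s) (subseqs w) ≡ has321 w
  contains []      = refl
  contains (x ∷ w) = trans (any-subseqs-∷ _ x w) (cong₂ _∨_
    (trans (any-cong (λ s → cong ((length s ≡ᵇ 2) ∧_) (decreasing-∷ x s)) (subseqs w)) (any-decFrom 2 x w))
    (contains w))

-- Standardisation: order embeddings omitting one value.

punch : ℕ → ℕ → ℕ
punch zero    x       = suc x
punch (suc r) zero    = zero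
punch (suc r) (suc x) = suc (punch r x)

toℕ-punchIn : ∀ {n} (r : Fin (suc n)) (x : Fin n) → toℕ (punchIn r x) ≡ punch (toℕ r) (toℕ x)
toℕ-punchIn zero    x       = refl
toℕ-punchIn (suc r) zero    = refl
toℕ-punchIn (suc r) (suc x) = cong suc (toℕ-punchIn r x)

punch-<ᵇ : ∀ r x y → (punch r x <ᵇ punch r y) ≡ (x <ᵇ y)
punch-<ᵇ zero    x       y       = refl
punch-<ᵇ (suc r) zero    zero    = refl
punch-<ᵇ (suc r) zero    (suc y) = refl
punch-<ᵇ (suc r) (suc x) zero    = refl
punch-<ᵇ (suc r) (suc x) (suc y) = punch-<ᵇ r x y

punch-≡ᵇ : ∀ r x y → (punch r x ≡ᵇ punch r y) ≡ (x ≡ᵇ y)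
punch-≡ᵇ zero    x       y       = refl
punch-≡ᵇ (suc r) zero    zero    = refl
punch-≡ᵇ (suc r) zero    (suc y) = refl
punch-≡ᵇ (suc r) (suc x) zero    = refl
punch-≡ᵇ (suc r) (suc x) (suc y) = punch-≡ᵇ r x y

punch-<ᵇ-low : ∀ {r b} x → b ≤ r → (punch r x <ᵇ b) ≡ (x <ᵇ b)
punch-<ᵇ-low x       z≤n       = refl
punch-<ᵇ-low zero    (s≤s b≤r) = refl
punch-<ᵇ-low (suc x) (s≤s b≤r) = punch-<ᵇ-low x b≤r

punch-<ᵇ-high : ∀ {r b} x → r ≤ b → (punch r x <ᵇ suc b) ≡ (x <ᵇ b)
punch-<ᵇ-high x       z≤n       = refl
punch-<ᵇ-high zero    (s≤s r≤b) = refl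
punch-<ᵇ-high (suc x) (s≤s r≤b) = punch-<ᵇ-high x r≤b

punch-≤ᵇ-low : ∀ {r j} x → j ≤ r → (j ≤ᵇ punch r x) ≡ (j ≤ᵇ x)
punch-≤ᵇ-low x       z≤n       = refl
punch-≤ᵇ-low zero    (s≤s j≤r) = refl
punch-≤ᵇ-low {suc r} {suc zero}    (suc x) (s≤s j≤r) = refl
punch-≤ᵇ-low {suc r} {suc (suc j)} (suc x) (s≤s j≤r) = punch-≤ᵇ-low x j≤r

punch-≤ᵇ-high : ∀ {r j} x → r ≤ j → (suc j ≤ᵇ punch r x) ≡ (j ≤ᵇ x)
punch-≤ᵇ-high {j = zero}  x       z≤n       = refl
punch-≤ᵇ-high {j = suc j} x       z≤n       = refl
punch-≤ᵇ-high             zero    (s≤s r≤j) = refl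
punch-≤ᵇ-high {j = suc zero}    (suc x) (s≤s r≤j) = punch-≤ᵇ-high x r≤j
punch-≤ᵇ-high {j = suc (suc j)} (suc x) (s≤s r≤j) = punch-≤ᵇ-high x r≤j

module _ (r : ℕ) where

  -- The correspondence of thresholds is a hypothesis because a threshold is kept up to `r` and
  -- shifted by one above it; the recursive calls use `punch-<ᵇ`.
  lisFrom-punch : ∀ {j j′} w → (∀ x → (j ≤ᵇ punch r x) ≡ (j′ ≤ᵇ x)) → lisFrom j (map (punch r) w) ≡ lisFrom j′ w
  lisFrom-punch []      eq = refl
  lisFrom-punch {j} {j′} (x ∷ w) eq
    rewrite eq x | lisFrom-punch {suc (punch r x)} {suc x} w (punch-<ᵇ r x) | lisFrom-punch {j} {j′} w eq = refl

  decBelow-punch : ∀ k {b b′} w → (∀ x → (punch r x <ᵇ b) ≡ (x <ᵇ b′)) → decBelow k b (map (punch r) w) ≡ decBelow k b′ w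
  decBelow-punch zero    w       eq = refl
  decBelow-punch (suc k) []      eq = refl
  decBelow-punch (suc k) (x ∷ w) eq = cong₂ _∨_
    (cong₂ _∧_ (eq x) (decBelow-punch k w (λ y → punch-<ᵇ r y x))) (decBelow-punch (suc k) w eq)

  below-punch : ∀ b b′ w → (∀ x → (punch r x <ᵇ b) ≡ (x <ᵇ b′)) → below b (map (punch r) w) ≡ below b′ w
  below-punch b b′ []      eq = refl
  below-punch b b′ (x ∷ w) eq rewrite eq x with x <ᵇ b′
  ... | true  = cong suc (below-punch b b′ w eq)
  ... | false = below-punch b b′ w eq

  inv-punch : ∀ w → inv (map (punch r) w) ≡ inv w
  inv-punch []      = refl
  inv-punch (x ∷ w) = cong₂ ℕ._+_ (below-punch (punch r x) x w (λ y → punch-<ᵇ r y x)) (inv-punch w)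

  has321-punch : ∀ w → has321 (map (punch r) w) ≡ has321 w
  has321-punch []      = refl
  has321-punch (x ∷ w) = cong₂ _∨_ (decBelow-punch 2 w (λ y → punch-<ᵇ r y x)) (has321-punch w)

  distinct-punch : ∀ w → distinctᵇ (map (punch r) w) ≡ distinctᵇ w
  distinct-punch []      = refl
  distinct-punch (x ∷ w) = cong₂ (λ a b → not a ∧ b)
    (trans (any-map (punch r x ≡ᵇ_) (punch r) w) (any-cong (punch-≡ᵇ r x) w)) (distinct-punch w)

-- States of words under prepending a value.

decBelow-1 : ∀ b w → decBelow 1 b w ≡ (0 <ᵇ below b w)
decBelow-1 b []      = refl
decBelow-1 b (x ∷ w) with x <ᵇ b
... | true  = refl
... | false = decBelow-1 b w

-- The last field says lisFrom j w = L − min(j, d), avoiding truncated subtraction.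
record State (n : ℕ) (w : List ℕ) (L d m : ℕ) : Set where
  field
    m≤n     : m ≤ n
    count   : ∀ b → b ≤ n → below b w ≡ b
    descent : ∀ b → b ≤ n → decBelow 2 b w ≡ (m <ᵇ b)
    lisAbove : ∀ j → j ≤ m → lisFrom j w ℕ.+ (j ⊓ d) ≡ L

prepend : ℕ → List ℕ → List ℕ
prepend r w = r ∷ map (punch r) w

<⇒<ᵇ≡true : ∀ {m n} → m < n → (m <ᵇ n) ≡ true
<⇒<ᵇ≡true {zero}  (s≤s p) = refl
<⇒<ᵇ≡true {suc m} (s≤s p) = <⇒<ᵇ≡true p

≤⇒<ᵇ≡false : ∀ {m n} → n ≤ m → (m <ᵇ n) ≡ false
≤⇒<ᵇ≡false z≤n     = refl
≤⇒<ᵇ≡false (s≤s p) = ≤⇒<ᵇ≡false p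

≤⇒≤ᵇ≡true : ∀ {m n} → m ≤ n → (m ≤ᵇ n) ≡ true
≤⇒≤ᵇ≡true z≤n     = refl
≤⇒≤ᵇ≡true (s≤s p) = <⇒<ᵇ≡true (s≤s p)

module _ {n w L d m} (s : State n w L d m) where
  open State s

  -- The field `count` records what is used of the entries being 0, ..., n - 1: the number of
  -- inversions added by a head and the presence of an entry below a positive head.
  count-prepend : ∀ {r} → r ≤ n → ∀ b → b ≤ suc n → below b (prepend r w) ≡ b
  count-prepend {r} r≤n b b≤ with ℕₚ.≤-<-connex b r
  ... | inj₁ b≤r rewrite ≤⇒<ᵇ≡false b≤r =
    trans (below-punch r b b w (λ x → punch-<ᵇ-low x b≤r)) (count b (ℕₚ.≤-trans b≤r r≤n))
  count-prepend {r} r≤n (suc b) (s≤s b≤n) | inj₂ (s≤s r≤b) rewrite <⇒<ᵇ≡true (s≤s r≤b) =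
    cong suc (trans (below-punch r (suc b) b w (λ x → punch-<ᵇ-high x r≤b)) (count b b≤n))

  lisFrom-prepend : ∀ {r j} → j ≤ r → lisFrom j (prepend r w) ≡ suc (lisFrom r w) ⊔ lisFrom j w
  lisFrom-prepend {r} {j} j≤r rewrite ≤⇒≤ᵇ≡true j≤r = cong₂ (λ x y → suc x ⊔ y)
    (lisFrom-punch r w (λ x → punch-≤ᵇ-high {r} x ℕₚ.≤-refl)) (lisFrom-punch r w (λ x → punch-≤ᵇ-low x j≤r))

  -- The head becomes the new bound. Up to it no decreasing pair existed, since it is at most m;
  -- above it the head and a smaller entry form such a pair, and `count` provides that entry because
  -- the head is positive.
  descent-prepend : ∀ {r} → suc r ≤ m → ∀ b → b ≤ suc n → decBelow 2 b (prepend (suc r) w) ≡ (suc r <ᵇ b)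
  descent-prepend {r} r<m b b≤ with ℕₚ.≤-<-connex b (suc r)
  ... | inj₁ b≤r rewrite ≤⇒<ᵇ≡false b≤r = trans (decBelow-punch (suc r) 2 w (λ x → punch-<ᵇ-low x b≤r))
    (trans (descent b (ℕₚ.≤-trans b≤r (ℕₚ.≤-trans r<m m≤n))) (≤⇒<ᵇ≡false (ℕₚ.≤-trans b≤r r<m)))
  ... | inj₂ r<b rewrite <⇒<ᵇ≡true r<b | decBelow-1 (suc r) (map (punch (suc r)) w)
      | below-punch (suc r) (suc r) (suc r) w (λ x → punch-<ᵇ-low {suc r} x ℕₚ.≤-refl)
      | count (suc r) (ℕₚ.≤-trans r<m m≤n) = refl

  -- A leading 0 prolongs any increasing subsequence, starts no decreasing pair, and is invisible to
  -- a threshold j + 1, which sees what j saw before.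
  state-zero : State (suc n) (prepend 0 w) (suc L) (suc d) (suc m)
  state-zero .State.m≤n = s≤s m≤n
  state-zero .State.count = count-prepend z≤n
  state-zero .State.descent zero    _ = trans (decBelow-punch 0 2 w (λ x → refl)) (descent 0 z≤n)
  state-zero .State.descent (suc b) (s≤s b≤n) = cong₂ _∨_
    (trans (decBelow-1 0 (map suc w)) (cong (0 <ᵇ_) (trans (below-punch 0 0 0 w (λ x → refl)) (count 0 z≤n))))
    (trans (decBelow-punch 0 2 w (λ x → refl)) (descent b b≤n))
  state-zero .State.lisAbove zero _ = begin
    lisFrom 0 (prepend 0 w) ℕ.+ 0           ≡⟨ ℕₚ.+-identityʳ _ ⟩
    lisFrom 0 (prepend 0 w)                 ≡⟨ lisFrom-prepend z≤n ⟩
    suc (lisFrom 0 w) ⊔ lisFrom 0 w         ≡⟨ ℕₚ.m≥n⇒m⊔n≡m (ℕₚ.n≤1+n _) ⟩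
    suc (lisFrom 0 w)                       ≡⟨ cong suc (trans (sym (ℕₚ.+-identityʳ _)) (lisAbove 0 z≤n)) ⟩
    suc L ∎
    where open ≡-Reasoning
  state-zero .State.lisAbove (suc j) (s≤s j≤m) = trans (ℕₚ.+-suc _ (j ⊓ d))
    (cong suc (trans (cong (ℕ._+ (j ⊓ d)) (lisFrom-punch 0 w (λ x → punch-≤ᵇ-high {j = j} x z≤n))) (lisAbove j j≤m)))

-- For `A` and `B` the values of `lisFrom` at r + 1 and j, the hypotheses say 1 + A = L - min(r, d)
-- and B = L - min(j, d + 1); the larger of the two is L - min(j, d, r).
max-plus : ∀ {A B L r d j} → A ℕ.+ (suc r ⊓ suc d) ≡ L → B ℕ.+ (j ⊓ suc d) ≡ L →
  (suc A ⊔ B) ℕ.+ (j ⊓ (d ⊓ r)) ≡ L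
max-plus {A} {B} {L} {r} {d} {j} eqA eqB with ℕₚ.≤-<-connex j (d ⊓ r)
... | inj₁ j≤e = begin
  (suc A ⊔ B) ℕ.+ (j ⊓ (d ⊓ r)) ≡⟨ cong₂ ℕ._+_ (ℕₚ.m≤n⇒m⊔n≡n A<B) (ℕₚ.m≤n⇒m⊓n≡m j≤e) ⟩
  B ℕ.+ j                       ≡⟨ eqB′ ⟩
  L                             ∎
  where
  open ≡-Reasoning
  eqB′ : B ℕ.+ j ≡ L
  eqB′ = trans (cong (B ℕ.+_) (sym (ℕₚ.m≤n⇒m⊓n≡m (ℕₚ.m≤n⇒m≤1+n (ℕₚ.≤-trans j≤e (ℕₚ.m⊓n≤m d r)))))) eqB
  A<B : suc A ≤ B
  A<B = ℕₚ.+-cancelʳ-≤ (d ⊓ r) (suc A) B (ℕₚ.≤-trans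
    (ℕₚ.≤-reflexive (trans (trans (sym (ℕₚ.+-suc A (d ⊓ r)))
      (trans (cong (λ x → A ℕ.+ suc x) (ℕₚ.⊓-comm d r)) eqA)) (sym eqB′)))
    (ℕₚ.+-monoʳ-≤ B j≤e))
... | inj₂ e<j = begin
  (suc A ⊔ B) ℕ.+ (j ⊓ (d ⊓ r)) ≡⟨ cong₂ ℕ._+_ (ℕₚ.m≥n⇒m⊔n≡m B≤A) (ℕₚ.m≥n⇒m⊓n≡n (ℕₚ.<⇒≤ e<j)) ⟩
  suc A ℕ.+ (d ⊓ r)             ≡⟨ eqA′ ⟩
  L                             ∎
  where
  open ≡-Reasoning
  eqA′ : suc A ℕ.+ (d ⊓ r) ≡ L
  eqA′ = trans (sym (ℕₚ.+-suc A (d ⊓ r))) (trans (cong (λ x → A ℕ.+ suc x) (ℕₚ.⊓-comm d r)) eqA)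
  B≤A : B ≤ suc A
  B≤A = ℕₚ.+-cancelʳ-≤ (d ⊓ r) B (suc A) (ℕₚ.≤-trans
    (ℕₚ.+-monoʳ-≤ B (ℕₚ.⊓-glb (ℕₚ.<⇒≤ e<j) (ℕₚ.m≤n⇒m≤1+n (ℕₚ.m⊓n≤m d r))))
    (ℕₚ.≤-reflexive (trans eqB (sym eqA′))))

-- With d = 0 all thresholds up to m give L, so the head adds one at every threshold up to itself.
state-suc₀ : ∀ {n w L m r} → State n w L 0 m → suc r ≤ m → State (suc n) (prepend (suc r) w) (suc L) 0 (suc r)
state-suc₀ s r<m .State.m≤n = ℕₚ.m≤n⇒m≤1+n (ℕₚ.≤-trans r<m (State.m≤n s))
state-suc₀ s r<m .State.count = count-prepend s (ℕₚ.≤-trans r<m (State.m≤n s))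
state-suc₀ s r<m .State.descent = descent-prepend s r<m
state-suc₀ {w = w} {L} {r = r} s r<m .State.lisAbove j j≤r = begin
  lisFrom j (prepend (suc r) w) ℕ.+ (j ⊓ 0)             ≡⟨ cong₂ ℕ._+_ (lisFrom-prepend s j≤r) (ℕₚ.⊓-zeroʳ j) ⟩
  (suc (lisFrom (suc r) w) ⊔ lisFrom j w) ℕ.+ 0 ≡⟨ ℕₚ.+-identityʳ _ ⟩
  suc (lisFrom (suc r) w) ⊔ lisFrom j w         ≡⟨ cong₂ (λ x y → suc x ⊔ y) (value (suc r) r<m) (value j (ℕₚ.≤-trans j≤r r<m)) ⟩
  suc L ⊔ L                                             ≡⟨ ℕₚ.m≥n⇒m⊔n≡m (ℕₚ.n≤1+n L) ⟩
  suc L ∎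
  where
  open ≡-Reasoning
  value : ∀ i → i ≤ _ → lisFrom i w ≡ L
  value i i≤m = trans (sym (trans (cong (lisFrom i w ℕ.+_) (ℕₚ.⊓-zeroʳ i)) (ℕₚ.+-identityʳ _))) (State.lisAbove s i i≤m)

-- With positive d, threshold r + 1 has already lost at least one, so the head brings the length
-- back to at most L.
state-suc₁ : ∀ {n w L d m r} → State n w L (suc d) m → suc r ≤ m → State (suc n) (prepend (suc r) w) L (d ⊓ r) (suc r)
state-suc₁ s r<m .State.m≤n = ℕₚ.m≤n⇒m≤1+n (ℕₚ.≤-trans r<m (State.m≤n s))
state-suc₁ s r<m .State.count = count-prepend s (ℕₚ.≤-trans r<m (State.m≤n s))
state-suc₁ s r<m .State.descent = descent-prepend s r<m
state-suc₁ {d = d} {r = r} s r<m .State.lisAbove j j≤r = trans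
  (cong (ℕ._+ (j ⊓ (d ⊓ r))) (lisFrom-prepend s j≤r))
  (max-plus {r = r} {d} {j} (State.lisAbove s (suc r) r<m) (State.lisAbove s j (ℕₚ.≤-trans j≤r r<m)))

-- Enumeration of 321-avoiding permutations by their first entry.

vals : ∀ {k m} → Vec (Fin m) k → List ℕ
vals v = map toℕ (toList v)

vals-punchIn : ∀ {k m} (r : Fin (suc m)) (v : Vec (Fin m) k) →
  vals (Vec.map (punchIn r) v) ≡ map (punch (toℕ r)) (vals v)
vals-punchIn r []      = refl
vals-punchIn r (x ∷ v) = cong₂ _∷_ (toℕ-punchIn r x) (vals-punchIn r v)

good : ∀ {n} → Vec (Fin n) n → Bool
good v = isPermᵇ v ∧ avoids321ᵇ (oneLine v)

module Enumeration where
  open import Data.Integer using (_+_; _*_; _-_; -_; _^_)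
  open TransferOperator
  open ≡-Reasoning

  sumList : {A : Set} → List A → (A → ℤ) → ℤ
  sumList xs f = foldr (λ x acc → f x + acc) 0ℤ xs

  sumFin : ∀ n → (Fin n → ℤ) → ℤ
  sumFin zero    f = 0ℤ
  sumFin (suc n) f = f zero + sumFin n (f ∘ suc)

  sumVec : ∀ k m → (Vec (Fin m) k → ℤ) → ℤ
  sumVec zero    m f = f []
  sumVec (suc k) m f = sumVec k m (λ v → sumFin m (λ x → f (x ∷ v)))

  sumList-++ : {A : Set} (xs ys : List A) (f : A → ℤ) → sumList (xs ++ ys) f ≡ sumList xs f + sumList ys f
  sumList-++ []       ys f = sym (ℤₚ.+-identityˡ _)
  sumList-++ (x ∷ xs) ys f = trans (cong (f x +_) (sumList-++ xs ys f)) (sym (ℤₚ.+-assoc (f x) _ _))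

  sumList-map : {A B : Set} (h : A → B) (xs : List A) (f : B → ℤ) → sumList (map h xs) f ≡ sumList xs (f ∘ h)
  sumList-map h []       f = refl
  sumList-map h (x ∷ xs) f = cong (f (h x) +_) (sumList-map h xs f)

  sumList-cong : {A : Set} {f h : A → ℤ} (xs : List A) → (∀ x → f x ≡ h x) → sumList xs f ≡ sumList xs h
  sumList-cong []       f≗h = refl
  sumList-cong (x ∷ xs) f≗h = cong₂ _+_ (f≗h x) (sumList-cong xs f≗h)

  sumList-concatMap : {A B : Set} (h : A → List B) (xs : List A) (f : B → ℤ) →
    sumList (concatMap h xs) f ≡ sumList xs (λ x → sumList (h x) f)
  sumList-concatMap h []       f = refl
  sumList-concatMap h (x ∷ xs) f = trans (sumList-++ (h x) (concatMap h xs) f)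
    (cong (sumList (h x) f +_) (sumList-concatMap h xs f))

  sumList-filterᵇ : {A : Set} (p : A → Bool) (xs : List A) (f : A → ℤ) →
    sumList (filterᵇ p xs) f ≡ sumList xs (λ x → if p x then f x else 0ℤ)
  sumList-filterᵇ p []       f = refl
  sumList-filterᵇ p (x ∷ xs) f with p x
  ... | true  = cong (f x +_) (sumList-filterᵇ p xs f)
  ... | false = trans (sumList-filterᵇ p xs f) (sym (ℤₚ.+-identityˡ _))

  sumList-tabulate : {A : Set} → ∀ n (h : Fin n → A) (f : A → ℤ) → sumList (tabulate h) f ≡ sumFin n (f ∘ h)
  sumList-tabulate zero    h f = refl
  sumList-tabulate (suc n) h f = cong (f (h zero) +_) (sumList-tabulate n (h ∘ suc) f)

  sumList-allVecs : ∀ k m (f : Vec (Fin m) k → ℤ) → sumList (allVecs k m) f ≡ sumVec k m f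
  sumList-allVecs zero    m f = ℤₚ.+-identityʳ (f [])
  sumList-allVecs (suc k) m f = begin
    sumList (concatMap (λ v → map (_∷ v) (allFin m)) (allVecs k m)) f
      ≡⟨ sumList-concatMap (λ v → map (_∷ v) (allFin m)) (allVecs k m) f ⟩
    sumList (allVecs k m) (λ v → sumList (map (_∷ v) (allFin m)) f)
      ≡⟨ sumList-cong (allVecs k m) (λ v →
           trans (sumList-map (_∷ v) (allFin m) f) (sumList-tabulate m id (λ x → f (x ∷ v)))) ⟩
    sumList (allVecs k m) (λ v → sumFin m (λ x → f (x ∷ v)))
      ≡⟨ sumList-allVecs k m (λ v → sumFin m (λ x → f (x ∷ v))) ⟩
    sumVec (suc k) m f ∎

  sumFin-cong : ∀ n {f h : Fin n → ℤ} → (∀ x → f x ≡ h x) → sumFin n f ≡ sumFin n h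
  sumFin-cong zero    f≗h = refl
  sumFin-cong (suc n) f≗h = cong₂ _+_ (f≗h zero) (sumFin-cong n (f≗h ∘ suc))

  sumVec-cong : ∀ k m {f h : Vec (Fin m) k → ℤ} → (∀ v → f v ≡ h v) → sumVec k m f ≡ sumVec k m h
  sumVec-cong zero    m f≗h = f≗h []
  sumVec-cong (suc k) m f≗h = sumVec-cong k m (λ v → sumFin-cong m (λ x → f≗h (x ∷ v)))

  sumFin-0 : ∀ n → sumFin n (λ _ → 0ℤ) ≡ 0ℤ
  sumFin-0 zero    = refl
  sumFin-0 (suc n) = trans (ℤₚ.+-identityˡ _) (sumFin-0 n)

  sumVec-0 : ∀ k m → sumVec k m (λ _ → 0ℤ) ≡ 0ℤ
  sumVec-0 zero    m = refl
  sumVec-0 (suc k) m = trans (sumVec-cong k m (λ _ → sumFin-0 m)) (sumVec-0 k m)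

  sumFin-+ : ∀ n (f h : Fin n → ℤ) → sumFin n (λ x → f x + h x) ≡ sumFin n f + sumFin n h
  sumFin-+ zero    f h = refl
  sumFin-+ (suc n) f h = trans (cong (f zero + h zero +_) (sumFin-+ n (f ∘ suc) (h ∘ suc)))
    (interchange (f zero) (h zero) (sumFin n (f ∘ suc)) (sumFin n (h ∘ suc)))
    where
    interchange : ∀ a b c d → a + b + (c + d) ≡ a + c + (b + d)
    interchange = solve-∀

  sumVec-+ : ∀ k m (f h : Vec (Fin m) k → ℤ) → sumVec k m (λ v → f v + h v) ≡ sumVec k m f + sumVec k m h
  sumVec-+ zero    m f h = refl
  sumVec-+ (suc k) m f h = trans (sumVec-cong k m (λ v → sumFin-+ m (λ x → f (x ∷ v)) (λ x → h (x ∷ v))))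
    (sumVec-+ k m _ _)

  sumVec-sumFin : ∀ k m n (f : Vec (Fin m) k → Fin n → ℤ) →
    sumVec k m (λ v → sumFin n (f v)) ≡ sumFin n (λ r → sumVec k m (λ v → f v r))
  sumVec-sumFin k m zero    f = sumVec-0 k m
  sumVec-sumFin k m (suc n) f = trans (sumVec-+ k m (λ v → f v zero) (λ v → sumFin n (f v ∘ suc)))
    (cong (sumVec k m (λ v → f v zero) +_) (sumVec-sumFin k m n (λ v → f v ∘ suc)))

  sumFin-if : ∀ n c (f : Fin n → ℤ) → sumFin n (λ x → if c then f x else 0ℤ) ≡ (if c then sumFin n f else 0ℤ)
  sumFin-if n true  f = refl
  sumFin-if n false f = sumFin-0 n

  sumFin-punchIn : ∀ n (r : Fin (suc n)) (f : Fin (suc n) → ℤ) →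
    sumFin (suc n) (λ x → if toℕ r ≡ᵇ toℕ x then 0ℤ else f x) ≡ sumFin n (f ∘ punchIn r)
  sumFin-punchIn n       zero    f = ℤₚ.+-identityˡ _
  sumFin-punchIn (suc n) (suc r) f = cong (f zero +_) (sumFin-punchIn n r (f ∘ suc))

  -- Vectors omitting the value `r` correspond bijectively, through `punchIn r`, to vectors over an
  -- alphabet smaller by one.
  sumVec-punchIn : ∀ k m (r : Fin (suc m)) (f : Vec (Fin (suc m)) k → ℤ) →
    sumVec k (suc m) (λ v → if any (toℕ r ≡ᵇ_) (vals v) then 0ℤ else f v) ≡ sumVec k m (f ∘ Vec.map (punchIn r))
  sumVec-punchIn zero    m r f = refl
  sumVec-punchIn (suc k) m r f = begin
    sumVec k (suc m) (λ v → sumFin (suc m) (λ x → if (toℕ r ≡ᵇ toℕ x) ∨ any (toℕ r ≡ᵇ_) (vals v) then 0ℤ else f (x ∷ v)))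
      ≡⟨ sumVec-cong k (suc m) (λ v → factor (any (toℕ r ≡ᵇ_) (vals v)) (λ x → f (x ∷ v))) ⟩
    sumVec k (suc m) (λ v → if any (toℕ r ≡ᵇ_) (vals v) then 0ℤ else
        sumFin (suc m) (λ x → if toℕ r ≡ᵇ toℕ x then 0ℤ else f (x ∷ v)))
      ≡⟨ sumVec-punchIn k m r _ ⟩
    sumVec k m (λ v → sumFin (suc m) (λ x → if toℕ r ≡ᵇ toℕ x then 0ℤ else f (x ∷ Vec.map (punchIn r) v)))
      ≡⟨ sumVec-cong k m (λ v → sumFin-punchIn m r (λ x → f (x ∷ Vec.map (punchIn r) v))) ⟩
    sumVec k m (λ v → sumFin m (λ x → f (punchIn r x ∷ Vec.map (punchIn r) v))) ∎
    where
    factor : ∀ c (h : Fin (suc m) → ℤ) → sumFin (suc m) (λ x → if (toℕ r ≡ᵇ toℕ x) ∨ c then 0ℤ else h x) ≡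
      (if c then 0ℤ else sumFin (suc m) (λ x → if toℕ r ≡ᵇ toℕ x then 0ℤ else h x))
    factor true  h = trans (sumFin-cong (suc m) (λ x → cong (if_then 0ℤ else h x) (Boolₚ.∨-zeroʳ (toℕ r ≡ᵇ toℕ x)))) (sumFin-0 (suc m))
    factor false h = sumFin-cong (suc m) (λ x → cong (if_then 0ℤ else h x) (Boolₚ.∨-identityʳ (toℕ r ≡ᵇ toℕ x)))

  sumGood : ∀ n → (Vec (Fin n) n → ℤ) → ℤ
  sumGood n F = sumVec n n (λ v → if good v then F v else 0ℤ)

  sumList-T : ∀ n F → sumList (T n) F ≡ sumGood n F
  sumList-T n F = trans (sumList-filterᵇ good (allVecs n n) F) (sumList-allVecs n n _)

  descents : ∀ {n} → Fin (suc n) → Vec (Fin n) n → Bool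
  descents r v = decBelow 2 (toℕ r) (oneLine v)

  -- With the head fixed, the tails omitting it are standardised; avoidance then splits into
  -- avoidance for the tail and the absence of a decreasing pair below the head.
  sumGood-suc : ∀ n F → sumGood (suc n) F ≡
    sumGood n (λ v → sumFin (suc n) (λ r → if descents r v then 0ℤ else F (r ∷ Vec.map (punchIn r) v)))
  sumGood-suc n F = begin
    sumVec n (suc n) (λ v → sumFin (suc n) (λ r → if good (r ∷ v) then F (r ∷ v) else 0ℤ))
      ≡⟨ sumVec-sumFin n (suc n) (suc n) (λ v r → if good (r ∷ v) then F (r ∷ v) else 0ℤ) ⟩
    sumFin (suc n) (λ r → sumVec n (suc n) (λ v → if good (r ∷ v) then F (r ∷ v) else 0ℤ))
      ≡⟨ sumFin-cong (suc n) (λ r → trans (sumVec-cong n (suc n) (isolate r)) (sumVec-punchIn n n r (rest r))) ⟩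
    sumFin (suc n) (λ r → sumVec n n (λ v → rest r (Vec.map (punchIn r) v)))
      ≡⟨ sumVec-sumFin n n (suc n) (λ v r → rest r (Vec.map (punchIn r) v)) ⟨
    sumVec n n (λ v → sumFin (suc n) (λ r → rest r (Vec.map (punchIn r) v)))
      ≡⟨ sumVec-cong n n (λ v → trans (sumFin-cong (suc n) (λ r → standardise r v))
           (sumFin-if (suc n) (good v) (λ r → if descents r v then 0ℤ else F (r ∷ Vec.map (punchIn r) v)))) ⟩
    _ ∎
    where
    rest : Fin (suc n) → Vec (Fin (suc n)) n → ℤ
    rest r v = if distinctᵇ (vals v) ∧ avoids321ᵇ (toℕ r ∷ vals v) then F (r ∷ v) else 0ℤ

    isolate : ∀ r v → (if good (r ∷ v) then F (r ∷ v) else 0ℤ) ≡ (if any (toℕ r ≡ᵇ_) (vals v) then 0ℤ else rest r v)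
    isolate r v with any (toℕ r ≡ᵇ_) (vals v)
    ... | true  = refl
    ... | false = refl

    reassoc : ∀ a b c (x : ℤ) → (if a ∧ not (b ∨ c) then x else 0ℤ) ≡ (if a ∧ not c then (if b then 0ℤ else x) else 0ℤ)
    reassoc false b     c     x = refl
    reassoc true  true  false x = refl
    reassoc true  true  true  x = refl
    reassoc true  false c     x = refl

    standardise : ∀ r v → rest r (Vec.map (punchIn r) v) ≡
      (if good v then (if descents r v then 0ℤ else F (r ∷ Vec.map (punchIn r) v)) else 0ℤ)
    standardise r v = begin
      (if distinctᵇ w ∧ avoids321ᵇ (toℕ r ∷ w) then x else 0ℤ)
        ≡⟨ cong (λ w → if distinctᵇ w ∧ avoids321ᵇ (toℕ r ∷ w) then x else 0ℤ) (vals-punchIn r v) ⟩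
      (if distinctᵇ w′ ∧ avoids321ᵇ (toℕ r ∷ w′) then x else 0ℤ)
        ≡⟨ cong₂ (λ a b → if a ∧ b then x else 0ℤ) (distinct-punch (toℕ r) (vals v))
             (trans (avoids321≡ (toℕ r ∷ w′)) (cong₂ (λ a b → not (a ∨ b))
               (decBelow-punch (toℕ r) 2 (vals v) (λ y → punch-<ᵇ-low {toℕ r} y ℕₚ.≤-refl)) (has321-punch (toℕ r) (vals v)))) ⟩
      (if distinctᵇ (vals v) ∧ not (descents r v ∨ has321 (vals v)) then x else 0ℤ)
        ≡⟨ reassoc (distinctᵇ (vals v)) (descents r v) (has321 (vals v)) x ⟩
      (if distinctᵇ (vals v) ∧ not (has321 (vals v)) then (if descents r v then 0ℤ else x) else 0ℤ)
        ≡⟨ cong (λ a → if distinctᵇ (vals v) ∧ a then (if descents r v then 0ℤ else x) else 0ℤ) (avoids321≡ (vals v)) ⟨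
      _ ∎
      where
      x = F (r ∷ Vec.map (punchIn r) v)
      w = vals (Vec.map (punchIn r) v)
      w′ = map (punch (toℕ r)) (vals v)

  -- From the enumeration to iterates of the operator.

  ∑-suc : ∀ ε f m → ∑ ε f (suc m) ≡ ε * (f 0 + ∑ ε (f ∘ suc) m)
  ∑-suc ε f zero = lemma ε (f 0)
    where
    lemma : ∀ e x → 0ℤ + e * 1ℤ * x ≡ e * (x + 0ℤ)
    lemma = solve-∀
  ∑-suc ε f (suc m) = trans (cong (_+ ε ^ suc (suc m) * f (suc m)) (∑-suc ε f m))
    (lemma ε (f 0) (∑ ε (f ∘ suc) m) (ε ^ suc m) (f (suc m)))
    where
    lemma : ∀ e a s p x → e * (a + s) + e * p * x ≡ e * (a + (s + p * x))
    lemma = solve-∀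

  -- The induction removes the first summand; the factor `c` is general so that it can absorb the
  -- power of ε this releases.
  sumFin-truncated : ∀ ε {m n} → m ≤ n → ∀ c f →
    sumFin n (λ r → if m <ᵇ suc (toℕ r) then 0ℤ else c * (ε ^ suc (toℕ r) * f (toℕ r))) ≡ c * ∑ ε f m
  sumFin-truncated ε {n = n} z≤n       c f = trans (sumFin-0 n) (sym (ℤₚ.*-zeroʳ c))
  sumFin-truncated ε {suc m} {suc n} (s≤s m≤n) c f = begin
    c * (ε ^ 1 * f 0) + sumFin n (λ r → if m <ᵇ suc (toℕ r) then 0ℤ else c * (ε ^ suc (suc (toℕ r)) * f (suc (toℕ r))))
      ≡⟨ cong (c * (ε ^ 1 * f 0) +_) (sumFin-cong n (λ r → cong (if m <ᵇ suc (toℕ r) then 0ℤ else_)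
           (regroup c ε (ε ^ suc (toℕ r)) (f (suc (toℕ r)))))) ⟩
    c * (ε ^ 1 * f 0) + sumFin n (λ r → if m <ᵇ suc (toℕ r) then 0ℤ else c * ε * (ε ^ suc (toℕ r) * f (suc (toℕ r))))
      ≡⟨ cong (c * (ε ^ 1 * f 0) +_) (sumFin-truncated ε m≤n (c * ε) (f ∘ suc)) ⟩
    c * (ε ^ 1 * f 0) + c * ε * ∑ ε (f ∘ suc) m
      ≡⟨ collect c ε (f 0) (∑ ε (f ∘ suc) m) ⟩
    c * (ε * (f 0 + ∑ ε (f ∘ suc) m))
      ≡⟨ cong (c *_) (∑-suc ε f m) ⟨
    c * ∑ ε f (suc m) ∎
    where
    regroup : ∀ c e p x → c * (e * p * x) ≡ c * e * (p * x)
    regroup = solve-∀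
    collect : ∀ c e x s → c * (e * 1ℤ * x) + c * e * s ≡ c * (e * (x + s))
    collect = solve-∀

  inv-prepend : ∀ {n w L d m} → State n w L d m → ∀ r → r ≤ n → inv (prepend r w) ≡ inv w ℕ.+ r
  inv-prepend {w = w} s r r≤n = trans
    (cong₂ ℕ._+_ (trans (below-punch r r r w (λ x → punch-<ᵇ-low {r} x ℕₚ.≤-refl)) (State.count s r r≤n)) (inv-punch r w))
    (ℕₚ.+-comm r (inv w))

  if-<ᵇ : ∀ m k {x y : ℤ} → (k ≤ m → x ≡ y) → (if m <ᵇ k then 0ℤ else x) ≡ (if m <ᵇ k then 0ℤ else y)
  if-<ᵇ m k eq with ℕₚ.≤-<-connex k m
  ... | inj₁ k≤m rewrite ≤⇒<ᵇ≡false k≤m = eq k≤m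
  ... | inj₂ m<k rewrite <⇒<ᵇ≡true m<k = refl

  -- Quantifying over every state of a word avoids computing one from it. The induction sums `F`
  -- over the admissible heads, which turns `g` into `Δ ε g`, down to the empty word in state (0, 0,
  -- 0).
  sumGood≡iter : ∀ ε n F g →
    (∀ v {L d m} → State n (oneLine v) L d m → F v ≡ ε ^ inv (oneLine v) * g L d m) →
    sumGood n F ≡ iter ε n g 0 0 0
  sumGood≡iter ε zero F g hyp = trans (hyp [] empty) (ℤₚ.*-identityˡ (g 0 0 0))
    where
    empty : State 0 [] 0 0 0
    empty .State.m≤n = z≤n
    empty .State.count zero    _ = refl
    empty .State.descent zero    _ = refl
    empty .State.lisAbove zero    _ = refl
  sumGood≡iter ε (suc n) F g hyp = trans (sumGood-suc n F) (sumGood≡iter ε n _ (Δ ε g) step)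
    where
    step : ∀ v {L d m} → State n (oneLine v) L d m →
      sumFin (suc n) (λ r → if descents r v then 0ℤ else F (r ∷ Vec.map (punchIn r) v)) ≡ ε ^ inv (oneLine v) * Δ ε g L d m
    step v {L} {d} {m} s = begin
      sumFin (suc n) (λ r → if descents r v then 0ℤ else F (r ∷ Vec.map (punchIn r) v))
        -- By `descent` a head is admissible exactly up to m; for head 0 the test computes to
        -- `false`.
        ≡⟨ sumFin-cong (suc n) (λ r → cong (if_then 0ℤ else F (r ∷ Vec.map (punchIn r) v))
             (State.descent s (toℕ r) (Finₚ.toℕ≤pred[n] r))) ⟩
      F (zero ∷ Vec.map (punchIn zero) v)
        + sumFin n (λ r → if m <ᵇ suc (toℕ r) then 0ℤ else F (suc r ∷ Vec.map (punchIn (suc r)) v))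
        ≡⟨ cong₂ _+_ first (sumFin-cong n (λ r → if-<ᵇ m (suc (toℕ r)) (later s r))) ⟩
      c * g (suc L) (suc d) (suc m) + sumFin n (λ r → if m <ᵇ suc (toℕ r) then 0ℤ else c * (ε ^ suc (toℕ r) * term g L d (toℕ r)))
        ≡⟨ cong (c * g (suc L) (suc d) (suc m) +_) (sumFin-truncated ε (State.m≤n s) c (term g L d)) ⟩
      c * g (suc L) (suc d) (suc m) + c * ∑ ε (term g L d) m
        ≡⟨ ℤₚ.*-distribˡ-+ c (g (suc L) (suc d) (suc m)) (∑ ε (term g L d) m) ⟨
      c * Δ ε g L d m ∎
      where
      c = ε ^ inv (oneLine v)

      apply : ∀ (r : Fin (suc n)) {L′ d′ m′} → State (suc n) (prepend (toℕ r) (oneLine v)) L′ d′ m′ →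
        F (r ∷ Vec.map (punchIn r) v) ≡ c * (ε ^ toℕ r * g L′ d′ m′)
      apply r {L′} {d′} {m′} s′ = begin
        F (r ∷ Vec.map (punchIn r) v)
          ≡⟨ hyp (r ∷ Vec.map (punchIn r) v) (subst (λ w → State (suc n) w L′ d′ m′) (sym eq) s′) ⟩
        ε ^ inv (oneLine (r ∷ Vec.map (punchIn r) v)) * g L′ d′ m′
          ≡⟨ cong (λ k → ε ^ k * g L′ d′ m′) (trans (cong inv eq) (inv-prepend s (toℕ r) (ℕ.s≤s⁻¹ (Finₚ.toℕ<n r)))) ⟩
        ε ^ (inv (oneLine v) ℕ.+ toℕ r) * g L′ d′ m′
          ≡⟨ cong (_* g L′ d′ m′) (ℤₚ.^-distribˡ-+-* ε (inv (oneLine v)) (toℕ r)) ⟩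
        c * ε ^ toℕ r * g L′ d′ m′
          ≡⟨ ℤₚ.*-assoc c (ε ^ toℕ r) (g L′ d′ m′) ⟩
        c * (ε ^ toℕ r * g L′ d′ m′) ∎
        where
        eq : oneLine (r ∷ Vec.map (punchIn r) v) ≡ prepend (toℕ r) (oneLine v)
        eq = cong (toℕ r ∷_) (vals-punchIn r v)

      first : F (zero ∷ Vec.map (punchIn zero) v) ≡ c * g (suc L) (suc d) (suc m)
      first = trans (apply zero (state-zero s)) (cong (c *_) (ℤₚ.*-identityˡ (g (suc L) (suc d) (suc m))))

      -- The second parameter is generalised so that matching on it selects the branch of `term`.
      later : ∀ {d} → State n (oneLine v) L d m → ∀ r → suc (toℕ r) ≤ m →
        F (suc r ∷ Vec.map (punchIn (suc r)) v) ≡ c * (ε ^ suc (toℕ r) * term g L d (toℕ r))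
      later {zero}  s r r<m = apply (suc r) (state-suc₀ s r<m)
      later {suc d} s r r<m = apply (suc r) (state-suc₁ s r<m)

  sum-T : ∀ ε n h → sumList (T n) (λ π → ε ^ inv (oneLine π) * h (lis π)) ≡ iter ε n (ofLis h) 0 0 0
  sum-T ε n h = trans (sumList-T n _) (sumGood≡iter ε n _ (ofLis h) (λ v s →
    cong (λ l → ε ^ inv (oneLine v) * h l) (trans (lis≡lisFrom v)
      (trans (sym (ℕₚ.+-identityʳ _)) (State.lisAbove s 0 z≤n)))))

  -- Coefficients of polynomials and the two identities.

  Σₚ-coefficient : {A : Set} (xs : List A) (f : A → Poly) → ∀ k → Σₚ xs f k ≡ sumList xs (λ x → f x k)
  Σₚ-coefficient []       f k = refl
  Σₚ-coefficient (x ∷ xs) f k = cong (f x k +_) (Σₚ-coefficient xs f k)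

  mono-scale : ∀ c e k → mono c e k ≡ c * mono 1ℤ e k
  mono-scale c e k with e ≡ᵇ k
  ... | true  = sym (ℤₚ.*-identityʳ c)
  ... | false = sym (ℤₚ.*-zeroʳ c)

  signedSum : ℕ → Poly
  signedSum n = Σₚ (T n) (λ π → mono (sign π) (lis π))

  lisSum : (ℕ → ℕ) → ℕ → Poly
  lisSum e n = Σₚ (T n) (λ π → mono 1ℤ (e (lis π)))

  signedSum≡iter : ∀ n k → signedSum n k ≡ iter -1ℤ n (ofLis (λ l → mono 1ℤ l k)) 0 0 0
  signedSum≡iter n k = trans (Σₚ-coefficient (T n) (λ π → mono (sign π) (lis π)) k) (trans
    (sumList-cong (T n) (λ π → mono-scale (sign π) (lis π) k)) (sum-T -1ℤ n (λ l → mono 1ℤ l k)))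

  lisSum≡iter : ∀ e n k → lisSum e n k ≡ iter 1ℤ n (ofLis (λ l → mono 1ℤ (e l) k)) 0 0 0
  lisSum≡iter e n k = trans (Σₚ-coefficient (T n) (λ π → mono 1ℤ (e (lis π))) k) (trans
    (sumList-cong (T n) (λ π → sym (trans
      (cong (_* mono 1ℤ (e (lis π)) k) (ℤₚ.^-zeroˡ (inv (oneLine π)))) (ℤₚ.*-identityˡ (mono 1ℤ (e (lis π)) k)))))
    (sum-T 1ℤ n (λ l → mono 1ℤ (e l) k)))

  lisSum-cong : ∀ {e e′} → (∀ l → e l ≡ e′ l) → ∀ n k → lisSum e n k ≡ lisSum e′ n k
  lisSum-cong {e} {e′} e≗e′ n k = trans (Σₚ-coefficient (T n) (λ π → mono 1ℤ (e (lis π))) k) (trans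
    (sumList-cong (T n) (λ π → cong (λ x → mono 1ℤ x k) (e≗e′ (lis π))))
    (sym (Σₚ-coefficient (T n) (λ π → mono 1ℤ (e′ (lis π))) k)))

  lisSum-suc-0 : ∀ e n → lisSum (suc ∘ e) n 0 ≡ 0ℤ
  lisSum-suc-0 e n = trans (Σₚ-coefficient (T n) (λ π → mono 1ℤ (suc (e (lis π)))) 0) (vanish (T n))
    where
    vanish : {A : Set} (xs : List A) → sumList xs (λ _ → 0ℤ) ≡ 0ℤ
    vanish []       = refl
    vanish (x ∷ xs) = trans (ℤₚ.+-identityˡ _) (vanish xs)

  lisSum-suc : ∀ e n k → lisSum (suc ∘ e) n (suc k) ≡ lisSum e n k
  lisSum-suc e n k = trans (Σₚ-coefficient (T n) (λ π → mono 1ℤ (suc (e (lis π)))) (suc k))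
    (sym (Σₚ-coefficient (T n) (λ π → mono 1ℤ (e (lis π))) k))

  sumUpTo-two : ∀ (f : ℕ → ℤ) → (∀ i → f (suc (suc i)) ≡ 0ℤ) → ∀ k → sumUpTo f (suc k) ≡ f 0 + f 1
  sumUpTo-two f f≡0 zero    = refl
  sumUpTo-two f f≡0 (suc k) = trans (cong₂ _+_ (sumUpTo-two f f≡0 k) (f≡0 k)) (ℤₚ.+-identityʳ (f 0 + f 1))

  q-1*ₚ-suc : ∀ P k → (q-1 *ₚ P) (suc k) ≡ P k - P (suc k)
  q-1*ₚ-suc P k = trans
    (sumUpTo-two (λ i → q-1 i * P (suc k ℕ.∸ i)) (λ i → ℤₚ.*-zeroˡ (P (suc k ℕ.∸ suc (suc i)))) k)
    (lemma (P (suc k)) (P k))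
    where
    lemma : ∀ a b → -1ℤ * a + 1ℤ * b ≡ b - a
    lemma = solve-∀

  -- Multiplication by q raises each exponent by one. Degree 0 is treated apart, where the shifted
  -- sum has no coefficient.
  q-1*ₚ-lisSum : ∀ e n → (q-1 *ₚ lisSum e n) ≈ₚ (λ k → lisSum (suc ∘ e) n k - lisSum e n k)
  q-1*ₚ-lisSum e n zero = begin
    -1ℤ * lisSum e n 0                    ≡⟨ ℤₚ.-1*i≡-i (lisSum e n 0) ⟩
    - lisSum e n 0                        ≡⟨ ℤₚ.+-identityˡ (- lisSum e n 0) ⟨
    0ℤ - lisSum e n 0                     ≡⟨ cong (_- lisSum e n 0) (lisSum-suc-0 e n) ⟨
    lisSum (suc ∘ e) n 0 - lisSum e n 0   ∎
  q-1*ₚ-lisSum e n (suc k) = trans (q-1*ₚ-suc (lisSum e n) k) (cong (_- lisSum e n (suc k)) (sym (lisSum-suc e n k)))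

  dbl≡2* : ∀ n → dbl n ≡ 2 ℕ.* n
  dbl≡2* zero    = refl
  dbl≡2* (suc n) = cong suc (trans (cong suc (dbl≡2* n)) (sym (ℕₚ.+-suc n (n ℕ.+ 0))))

  suc-dbl : ∀ l → 2 ℕ.* l ℕ.+ 1 ≡ suc (dbl l ℕ.+ 0)
  suc-dbl l = trans (cong (ℕ._+ 1) (sym (dbl≡2* l))) (ℕₚ.+-suc (dbl l) 0)

  oddSum : ℕ → Poly
  oddSum = lisSum (λ l → 2 ℕ.* l ℕ.+ 1)

  oddSum≡iter : ∀ n k → oddSum n k ≡ iter 1ℤ n (ofLis (λ l → mono 1ℤ (suc (dbl l ℕ.+ 0)) k)) 0 0 0
  oddSum≡iter n k = trans (lisSum-cong suc-dbl n k) (lisSum≡iter (λ l → suc (dbl l ℕ.+ 0)) n k)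

  signedSum-odd : ∀ n → signedSum (2 ℕ.* n ℕ.+ 1) ≈ₚ oddSum n
  signedSum-odd n k = begin
    signedSum (2 ℕ.* n ℕ.+ 1) k                           ≡⟨ cong (λ N → signedSum N k) length-odd ⟩
    signedSum (suc (dbl n)) k                             ≡⟨ signedSum≡iter (suc (dbl n)) k ⟩
    iter -1ℤ (suc (dbl n)) (ofLis h) 0 0 0                ≡⟨ iter-restrict h 0 n ⟩
    iter 1ℤ n (ofLis (λ l → h (suc (dbl l ℕ.+ 0)))) 0 0 0 ≡⟨ oddSum≡iter n k ⟨
    oddSum n k                                            ∎
    where
    h : ℕ → ℤ
    h l = mono 1ℤ l k
    length-odd : 2 ℕ.* n ℕ.+ 1 ≡ suc (dbl n)
    length-odd = trans (ℕₚ.+-comm (2 ℕ.* n) 1) (cong suc (sym (dbl≡2* n)))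

  signedSum-even : ∀ n → signedSum (2 ℕ.* n ℕ.+ 2) ≈ₚ (q-1 *ₚ oddSum n)
  signedSum-even n k = begin
    signedSum (2 ℕ.* n ℕ.+ 2) k                           ≡⟨ cong (λ N → signedSum N k) length-even ⟩
    signedSum (dbl (suc n)) k                             ≡⟨ signedSum≡iter (dbl (suc n)) k ⟩
    iter -1ℤ (dbl (suc n)) (ofLis h) 0 0 0                ≡⟨ iter-even h n ⟩
    iter 1ℤ n (ofLis (λ l → h (suc (dbl l ℕ.+ 1)))) 0 0 0
      - iter 1ℤ n (ofLis (λ l → h (suc (dbl l ℕ.+ 0)))) 0 0 0
        -- Offset 1 gives the exponent 2 lis + 2 and offset 0 the exponent 2 lis + 1, whence the
        -- factor q - 1.
        ≡⟨ cong₂ _-_ (trans (lisSum-cong (λ l → cong (λ x → suc (x ℕ.+ 1)) (sym (dbl≡2* l))) n k)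
                        (lisSum≡iter (λ l → suc (dbl l ℕ.+ 1)) n k))
                     (oddSum≡iter n k) ⟨
    lisSum (λ l → suc (2 ℕ.* l ℕ.+ 1)) n k - oddSum n k   ≡⟨ q-1*ₚ-lisSum (λ l → 2 ℕ.* l ℕ.+ 1) n k ⟨
    (q-1 *ₚ oddSum n) k                                   ∎
    where
    h : ℕ → ℤ
    h l = mono 1ℤ l k
    length-even : 2 ℕ.* n ℕ.+ 2 ≡ dbl (suc n)
    length-even = trans (ℕₚ.+-comm (2 ℕ.* n) 2) (cong (λ x → suc (suc x)) (sym (dbl≡2* n)))

open Enumeration
open import Data.Integer using (+_)
open import Data.Nat using (_+_; _*_; _≥_)

theorem1p1 : (n : ℕ) → n ≥ 1 →
    (Σₚ (T (2 * n + 1)) (λ π → mono (sign π) (lis π))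
    ≈ₚ Σₚ (T n) (λ π → mono (+ 1) (2 * lis π + 1)))
    × (Σₚ (T (2 * n + 2)) (λ π → mono (sign π) (lis π))
    ≈ₚ (q-1 *ₚ Σₚ (T n) (λ π → mono (+ 1) (2 * lis π + 1))))
theorem1p1 n _ = signedSum-odd n , signedSum-even n
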